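{- Let $q$ be an even prime power and let $L$ be a line of $\mathrm{PG}(5,q)$ in the $K$-orbit $o_{8,3}$. Then the hyperplane-orbit distribution of $L$ is $OD_4(L)=[q+1,\,q^2+q,\,0,\,q^3-q]$.
   Context: A point $(y_0,\dots,y_5)$ of $\mathrm{PG}(5,q)$ is identified with the nonzero symmetric matrix $\begin{bmatrix} y_0&y_1&y_2\\ y_1&y_3&y_4\\ y_2&y_4&y_5\end{bmatrix}$ up to scalar. $K\cong\mathrm{PGL}(3,q)$ acts by $M\mapsto AMA^T$, $A\in\mathrm{GL}(3,q)$. The orbit $o_{8,3}$ (defined only for $q$ even) is the $K$-orbit of the line $\left\{\begin{bmatrix}x&0&0\\0&0&y\\0&y&0\end{bmatrix}:(x,y)\in\mathrm{PG}(1,q)\right\}$. Hyperplanes correspond to conics of $\mathrm{PG}(2,q)$ (nonzero quadratic forms up to scalar): $\sum_{0\le i\le j\le2}a_{ij}X_iX_j$ corresponds to $a_{00}Y_0+a_{01}Y_1+a_{02}Y_2+a_{11}Y_3+a_{12}Y_4+a_{22}Y_5=0$. $\mathcal H_1,\mathcal H_{2,r},\mathcal H_{2,i},\mathcal H_3$ are the sets of hyperplanes corresponding respectively to double lines (scalar multiples of squares of linear forms), pairs of distinct real lines (products of two non-proportional linear forms over $\mathbb F_q$), pairs of conjugate imaginary lines (scalar multiples of products of two non-proportional linear forms conjugate over $\mathbb F_{q^2}$), and non-singular conics (those with $4a_{00}a_{11}a_{22}+a_{01}a_{02}a_{12}-a_{00}a_{12}^2-a_{11}a_{02}^2-a_{22}a_{01}^2\ne0$).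 $OD_4(L)=[h_1,h_{2,r},h_{2,i},h_3]$ lists the numbers of hyperplanes in $\mathcal H_1,\mathcal H_{2,r},\mathcal H_{2,i},\mathcal H_3$ containing $L$. -}

module Defs where

open import Algebra.Bundles using (CommutativeRing; Semiring)
import Algebra.Definitions as AlgDefs
import Algebra.Definitions.RawMonoid as RawMonoidDefs
import Algebra.Definitions.RawSemiring as RawSemiringDefs
open import Algebra.Morphism.Structures using (IsRingHomomorphism)
open import Data.Fin.Base using (Fin)
open import Data.Fin.Patterns using (0F; 1F; 2F; 3F; 4F; 5F)
open import Data.Nat.Base using (ℕ; suc; _^_)
open import Data.Nat.Divisibility using (_∣_)
open import Data.Nat.Primality using (Prime)
open import Data.Product.Base using (Σ-syntax; ∃-syntax; _×_; _,_; proj₁; proj₂)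
open import Data.Vec.Base as Vec using (Vec)
open import Data.Vec.Functional using (Vector; []; _∷_)
open import Function.Bundles using (Inverse)
open import Level using (Level; _⊔_) renaming (suc to lsuc)
open import Relation.Binary.Bundles using (Setoid)
import Relation.Binary.Construct.On as On
open import Relation.Binary.PropositionalEquality.Core using (_≡_)
import Relation.Binary.PropositionalEquality.Properties as ≡
open import Relation.Binary.Structures using (IsEquivalence)
import Relation.Binary.Reasoning.Setoid as SetoidReasoning
open import Relation.Nullary.Negation.Core using (¬_)
open import Relation.Unary using (Pred; _∈_; _≐_)

private
  variable
    a c ℓ p : Level

IsEvenPrimePower : ℕ → Set
IsEvenPrimePower q = (∃[ r ] ∃[ k ] Prime r × q ≡ r ^ suc k) × 2 ∣ q

-- The setoid S has exactly n elements up to its equality.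
HasSize : Setoid a ℓ → ℕ → Set (a ⊔ ℓ)
HasSize S n = Inverse (≡.setoid (Fin n)) S

-- A finite set has decidable equality, so "nonzero" is plain negation here
-- rather than the apartness of the library's HeytingField.
record FiniteField (q : ℕ) (c ℓ : Level) : Set (lsuc (c ⊔ ℓ)) where
  field
    commutativeRing : CommutativeRing c ℓ
  open CommutativeRing commutativeRing public
  field
    0≉1        : ¬ 0# ≈ 1#
    invertible : ∀ {x} → ¬ x ≈ 0# → AlgDefs.Invertible _≈_ 1# _*_ x
    size       : HasSize setoid q

module Projective {q : ℕ} (F : FiniteField q c ℓ) where
  open FiniteField F
  open RawMonoidDefs +-rawMonoid public using (sum)
  open SetoidReasoning setoid

  infix 4 _∼_ _∼ₘ_

  _∼_ : ∀ {n} → Vector Carrier n → Vector Carrier n → Set (c ⊔ ℓ)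
  u ∼ v = ∃[ k ] ¬ k ≈ 0# × (∀ i → u i ≈ k * v i)

  ∼-refl : ∀ {n} {u : Vector Carrier n} → u ∼ u
  ∼-refl = 1# , (λ 1≈0 → 0≉1 (sym 1≈0)) , λ i → sym (*-identityˡ _)

  ∼-sym : ∀ {n} {u v : Vector Carrier n} → u ∼ v → v ∼ u
  ∼-sym {u = u} {v} (k , k≉0 , u≈kv) with invertible k≉0
  ... | k⁻¹ , k⁻¹k≈1 , _ = k⁻¹ , k⁻¹≉0 , v≈k⁻¹u
    where
    k⁻¹≉0 : ¬ k⁻¹ ≈ 0#
    k⁻¹≉0 k⁻¹≈0 = 0≉1 (begin
      0#       ≈⟨ zeroˡ k ⟨
      0# * k   ≈⟨ *-congʳ k⁻¹≈0 ⟨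
      k⁻¹ * k  ≈⟨ k⁻¹k≈1 ⟩
      1#       ∎)
    v≈k⁻¹u : ∀ i → v i ≈ k⁻¹ * u i
    v≈k⁻¹u i = begin
      v i              ≈⟨ *-identityˡ _ ⟨
      1# * v i         ≈⟨ *-congʳ k⁻¹k≈1 ⟨
      k⁻¹ * k * v i    ≈⟨ *-assoc _ _ _ ⟩
      k⁻¹ * (k * v i)  ≈⟨ *-congˡ (u≈kv i) ⟨
      k⁻¹ * u i        ∎

  ∼-trans : ∀ {n} {u v w : Vector Carrier n} → u ∼ v → v ∼ w → u ∼ w
  ∼-trans {u = u} {v} {w} (k , k≉0 , u≈kv) (m , m≉0 , v≈mw) =
    k * m , km≉0 , λ i → begin
      u i            ≈⟨ u≈kv i ⟩
      k * v i        ≈⟨ *-congˡ (v≈mw i) ⟩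
      k * (m * w i)  ≈⟨ *-assoc _ _ _ ⟨
      k * m * w i    ∎
    where
    km≉0 : ¬ k * m ≈ 0#
    km≉0 km≈0 with invertible k≉0
    ... | k⁻¹ , k⁻¹k≈1 , _ = m≉0 (begin
      m              ≈⟨ *-identityˡ _ ⟨
      1# * m         ≈⟨ *-congʳ k⁻¹k≈1 ⟨
      k⁻¹ * k * m    ≈⟨ *-assoc _ _ _ ⟩
      k⁻¹ * (k * m)  ≈⟨ *-congˡ km≈0 ⟩
      k⁻¹ * 0#       ≈⟨ zeroʳ _ ⟩
      0#             ∎)

  ∼-isEquivalence : ∀ {n} → IsEquivalence (_∼_ {n})
  ∼-isEquivalence = record { refl = ∼-refl ; sym = ∼-sym ; trans = ∼-trans }

  PG : ℕ → Set (c ⊔ ℓ)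
  PG n = Σ[ v ∈ Vector Carrier (suc n) ] ¬ (∀ i → v i ≈ 0#)

  PG-setoid : ℕ → Setoid (c ⊔ ℓ) (c ⊔ ℓ)
  PG-setoid n = record
    { Carrier       = PG n
    ; _≈_           = λ P Q → proj₁ P ∼ proj₁ Q
    ; isEquivalence = On.isEquivalence proj₁ ∼-isEquivalence
    }

  Matrix : Set c
  Matrix = Fin 3 → Fin 3 → Carrier

  _∼ₘ_ : Matrix → Matrix → Set (c ⊔ ℓ)
  M ∼ₘ N = ∃[ k ] ¬ k ≈ 0# × (∀ i j → M i j ≈ k * N i j)

  infixl 7 _⊡_

  _⊡_ : Matrix → Matrix → Matrix
  (M ⊡ N) i j = sum λ k → M i k * N k j

  _ᵀ : Matrix → Matrix
  (M ᵀ) i j = M j i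

  identity : Matrix
  identity = (1# ∷ 0# ∷ 0# ∷ [])
           ∷ (0# ∷ 1# ∷ 0# ∷ [])
           ∷ (0# ∷ 0# ∷ 1# ∷ [])
           ∷ []

  GL₃ : Set (c ⊔ ℓ)
  GL₃ = Σ[ A ∈ Matrix ]
    AlgDefs.Invertible (λ M N → ∀ i j → M i j ≈ N i j) identity _⊡_ A

  symMatrix : Vector Carrier 6 → Matrix
  symMatrix y = (y 0F ∷ y 1F ∷ y 2F ∷ [])
              ∷ (y 1F ∷ y 3F ∷ y 4F ∷ [])
              ∷ (y 2F ∷ y 4F ∷ y 5F ∷ [])
              ∷ []

  PointSet : Set (lsuc (c ⊔ ℓ))
  PointSet = Pred (PG 5) (c ⊔ ℓ)

  infixr 8 _∙_

  _∙_ : GL₃ → PointSet → PointSet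
  ((A , _) ∙ S) (y , _) =
    Σ[ Q ∈ PG 5 ] Q ∈ S × symMatrix y ∼ₘ (A ⊡ symMatrix (proj₁ Q) ⊡ A ᵀ)

  record Line : Set (c ⊔ ℓ) where
    field
      P₁ P₂    : PG 5
      distinct : ¬ proj₁ P₁ ∼ proj₁ P₂

    points : PointSet
    points (y , _) =
      ∃[ s ] ∃[ t ] (∀ i → y i ≈ s * proj₁ P₁ i + t * proj₁ P₂ i)

  open Line public using (points)

  representative₈,₃ : PointSet
  representative₈,₃ (y , _) = Σ[ (v , _) ∈ PG 1 ]
    symMatrix y ∼ₘ ( (v 0F ∷ 0#   ∷ 0#   ∷ [])
                   ∷ (0#   ∷ 0#   ∷ v 1F ∷ [])
                   ∷ (0#   ∷ v 1F ∷ 0#   ∷ [])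
                   ∷ [])

  o₈,₃ : Pred Line (c ⊔ ℓ)
  o₈,₃ L = Σ[ A ∈ GL₃ ] points L ≐ A ∙ representative₈,₃

  LinearForm : Set c
  LinearForm = Vector Carrier 3

  -- Coefficients in the order a₀₀, a₀₁, a₀₂, a₁₁, a₁₂, a₂₂, so that position i
  -- is also the coefficient of Yᵢ in the equation of the hyperplane.
  QuadraticForm : Set c
  QuadraticForm = Vector Carrier 6

  infixl 7 _⊗_

  _⊗_ : LinearForm → LinearForm → QuadraticForm
  l ⊗ m = l 0F * m 0F
        ∷ l 0F * m 1F + l 1F * m 0F
        ∷ l 0F * m 2F + l 2F * m 0F
        ∷ l 1F * m 1F
        ∷ l 1F * m 2F + l 2F * m 1F
        ∷ l 2F * m 2F
        ∷ []

-- The field of order q² over F, with the embedding of F into it.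
record QuadraticExtension {q : ℕ} (F : FiniteField q c ℓ) : Set (lsuc (c ⊔ ℓ)) where
  private module F = FiniteField F
  field
    field-q² : FiniteField (q ^ 2) c ℓ
  open FiniteField field-q² public
  field
    ι                  : F.Carrier → Carrier
    ι-isHomomorphism   : IsRingHomomorphism F.rawRing rawRing ι
  open Projective field-q² public using (LinearForm; _⊗_; _∼_)

  conjugate : LinearForm → LinearForm
  conjugate l i = l i ^ᴷ q
    where open RawSemiringDefs (Semiring.rawSemiring semiring) renaming (_^_ to _^ᴷ_)

module Hyperplanes {q : ℕ} (F : FiniteField q c ℓ) where
  open FiniteField F
  open Projective F
  open RawMonoidDefs +-rawMonoid using () renaming (_×_ to _•_)

  Hyperplane : Set (c ⊔ ℓ)
  Hyperplane = PG 5

  Incident : Hyperplane → PG 5 → Set ℓ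
  Incident (a , _) (y , _) = sum (λ i → a i * y i) ≈ 0#

  Contains : Hyperplane → Line → Set (c ⊔ ℓ)
  Contains H L = ∀ P → P ∈ points L → Incident H P

  ℋ₁ : Pred Hyperplane (c ⊔ ℓ)
  ℋ₁ (a , _) = ∃[ k ] Σ[ l ∈ LinearForm ] (∀ i → a i ≈ k * (l ⊗ l) i)

  -- As a is nonzero, neither factor can vanish here; likewise in ℋ₂ᵢ.
  ℋ₂ᵣ : Pred Hyperplane (c ⊔ ℓ)
  ℋ₂ᵣ (a , _) = Σ[ l ∈ LinearForm ] Σ[ m ∈ LinearForm ]
    ¬ l ∼ m × (∀ i → a i ≈ (l ⊗ m) i)

  -- The extension exists and is unique up to isomorphism over F, so the choice
  -- of it is immaterial.
  ℋ₂ᵢ : Pred Hyperplane (lsuc (c ⊔ ℓ))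
  ℋ₂ᵢ (a , _) = Σ[ E ∈ QuadraticExtension F ]
    let module E = QuadraticExtension E in
    ∃[ k ] Σ[ l ∈ E.LinearForm ]
      ¬ l E.∼ E.conjugate l
      × (∀ i → E.ι (a i) E.≈ E.ι k E.* (l E.⊗ E.conjugate l) i)

  ℋ₃ : Pred Hyperplane ℓ
  ℋ₃ (a , _) = ¬
    4 • (a₀₀ * a₁₁ * a₂₂) + a₀₁ * a₀₂ * a₁₂
      - a₀₀ * (a₁₂ * a₁₂) - a₁₁ * (a₀₂ * a₀₂) - a₂₂ * (a₀₁ * a₀₁) ≈ 0#
    where
    a₀₀ = a 0F
    a₀₁ = a 1F
    a₀₂ = a 2F
    a₁₁ = a 3F
    a₁₂ = a 4F
    a₂₂ = a 5F

  -- Equality is that of PG(5,q); the membership proofs are ignored.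
  through : Pred Hyperplane p → Line → Setoid (c ⊔ ℓ ⊔ p) (c ⊔ ℓ)
  through ℋ L = On.setoid {B = Σ[ H ∈ Hyperplane ] H ∈ ℋ × Contains H L}
    (PG-setoid 5) proj₁

  HasOD₄ : Line → Vec ℕ 4 → Set (lsuc (c ⊔ ℓ))
  HasOD₄ L (h₁ Vec.∷ h₂ᵣ Vec.∷ h₂ᵢ Vec.∷ h₃ Vec.∷ Vec.[]) =
      HasSize (through ℋ₁  L) h₁
    × HasSize (through ℋ₂ᵣ L) h₂ᵣ
    × HasSize (through ℋ₂ᵢ L) h₂ᵢ
    × HasSize (through ℋ₃  L) h₃

{-# OPTIONS --safe #-}

-- If A carries the representative line to L, substituting A X for X turns the
-- hyperplanes through L into the conics without X₀² and X₁X₂ terms, that is into the points (b, c, d, e) of PG(3,q) via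
-- b X₀X₁ + c X₀X₂ + d X₁² + e X₂².  In characteristic 2 the discriminant of a
-- conic is its value at the nucleus, here d c² + e b².  If b = c = 0, the conic is
-- a double line because every element is a square.  Otherwise scale (b, c) to one
-- of q + 1 representatives and write (d, e) as t (b², c²) plus w times a fixed
-- complementary vector, where w is the discriminant: for w = 0 the conic is
-- (b X₁ + c X₂) (X₀ + t (b X₁ + c X₂)), for w ≠ 0 it is non-singular.
--
-- A conjugate pair of lines whose hyperplane contains L passes through the rational
-- point A e₀.  If only one of the lines does, its coefficients can be read off those
-- of the conic, so the line is rational and equals its conjugate; if both do, the
-- missing X₁X₂ term makes them coincide.

module Submission where

open import Defs
open import Algebra.Bundles using (RawRing)
import Algebra.Definitions.RawMonoid as RawMonoidDefs
open import Algebra.Morphism.Structures using (IsRingHomomorphism)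
import Algebra.Properties.CommutativeMonoid.Sum as CommutativeMonoidSum
import Algebra.Properties.CommutativeSemigroup as CommutativeSemigroupProperties
import Algebra.Properties.CommutativeSemiring.Exp as Exp
import Algebra.Properties.Group as GroupProperties
import Algebra.Properties.Ring as RingProperties
import Algebra.Properties.Semiring.Sum as SemiringSum
import Algebra.Solver.Ring as RingSolver
open import Algebra.Solver.Ring.AlmostCommutativeRing
  using (fromCommutativeRing; _-Raw-AlmostCommutative⟶_)
open import Data.Bool.Base using (Bool; true; false; _xor_; _∧_)
open import Data.Fin.Base using (Fin; punchIn; punchOut; suc)
open import Data.Fin.Patterns using (0F; 1F; 2F; 3F; 4F; 5F)
import Data.Fin.Properties as Fin
open import Data.Maybe.Base using (Maybe; just; nothing)
open import Data.Nat.Base as ℕ using (ℕ; zero; suc; _∸_)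
open import Data.Nat.Divisibility using (_∣_; ∣m⇒∣m*n)
import Data.Nat.Properties as ℕ
open import Data.Nat.Solver using (module +-*-Solver)
open import Data.Product.Base using (Σ-syntax; ∃-syntax; _×_; _,_; proj₁; proj₂)
open import Data.Product.Function.NonDependent.Setoid using (_×-inverse_)
import Data.Product.Relation.Binary.Pointwise.NonDependent as ×
open import Data.Sum.Base using (inj₁; inj₂)
open import Data.Sum.Function.Setoid using (_⊎-inverse_)
import Data.Sum.Relation.Binary.Pointwise as ⊎
import Data.Vec.Functional as Vector
open Vector using (Vector)
open import Data.Vec.N-ary using (N-ary)
open import Function.Base using (_∘_; id)
open import Function.Bundles using (Inverse)
open import Function.Construct.Composition using () renaming (inverse to _⟨∘⟩_)
import Function.Construct.Identity as Identity
open import Function.Construct.Symmetry using () renaming (inverse to flip)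
open import Function.Properties.Bijection using (Bijection⇒Inverse)
open import Level using (Level)
open import Relation.Binary.Bundles using (Setoid)
import Relation.Binary.Construct.On as On
open import Relation.Binary.Definitions using (Decidable)
open import Relation.Binary.PropositionalEquality as ≡ using (_≡_)
import Relation.Binary.Reasoning.Setoid as SetoidReasoning
open import Relation.Nullary.Decidable.Core using (Dec; yes; no; map′; decidable-stable)
open import Relation.Nullary.Negation.Core using (¬_; contradiction)
open import Relation.Unary using (Pred; _∈_; _≐_)

private
  variable
    a b c ℓ ℓ′ p : Level

-- Sizes of setoids.

hasSize-via : {S : Setoid a ℓ} {T : Setoid b ℓ′} {n : ℕ} →
  (let module S = Setoid S; module T = Setoid T) →
  HasSize S n → (f : S.Carrier → T.Carrier) →
  (∀ {x y} → x S.≈ y → f x T.≈ f y) →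
  (∀ {x y} → f x T.≈ f y → x S.≈ y) →
  (∀ y → ∃[ x ] f x T.≈ y) →
  HasSize T n
hasSize-via {S = S} {T} size f f-cong f-injective f-surjective =
  size ⟨∘⟩ Bijection⇒Inverse (record
    { to        = f
    ; cong      = f-cong
    ; bijective = f-injective , λ y → let x , fx≈y = f-surjective y in
        x , λ z≈x → Setoid.trans T (f-cong z≈x) fx≈y
    })

hasSize-⊎ : {S : Setoid a ℓ} {T : Setoid b ℓ′} {m n : ℕ} →
  HasSize S m → HasSize T n → HasSize (S ⊎.⊎ₛ T) (m ℕ.+ n)
hasSize-⊎ sizeS sizeT =
  Fin.+↔⊎ ⟨∘⟩ (flip (⊎.Pointwise-≡↔≡ _ _) ⟨∘⟩ (sizeS ⊎-inverse sizeT))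

hasSize-× : {S : Setoid a ℓ} {T : Setoid b ℓ′} {m n : ℕ} →
  HasSize S m → HasSize T n → HasSize (S ×.×ₛ T) (m ℕ.* n)
hasSize-× sizeS sizeT =
  Fin.*↔× ⟨∘⟩ (flip ×.Pointwise-≡↔≡ ⟨∘⟩ (sizeS ×-inverse sizeT))

infixl 6 _-ₛ_

_-ₛ_ : (S : Setoid a ℓ) → Setoid.Carrier S → Setoid _ ℓ
S -ₛ x = On.setoid {B = Σ[ y ∈ Setoid.Carrier S ] ¬ Setoid._≈_ S y x} S proj₁

-- `punchIn` at the index of `x` enumerates the remaining indices, and `punchOut` recovers the index
-- of an element different from `x`.
hasSize-- : {S : Setoid a ℓ} {n : ℕ} → HasSize S n →
  (x : Setoid.Carrier S) → HasSize (S -ₛ x) (n ∸ 1)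
hasSize-- {S = S} {zero} size x with () ← Inverse.from size x
hasSize-- {S = S} {suc n} size x = hasSize-via identity
  (λ i → to (punchIn (from x) i) , λ to≈x →
    Fin.punchInᵢ≢i (from x) i (≡.trans (≡.sym (strictlyInverseʳ _)) (from-cong to≈x)))
  (λ { ≡.refl → refl })
  (λ {i} {j} eq → Fin.punchIn-injective (from x) i j
    (≡.trans (≡.sym (strictlyInverseʳ _)) (≡.trans (from-cong eq) (strictlyInverseʳ _))))
  λ (y , y≉x) → let x≢y = λ eq → y≉x (trans (sym (strictlyInverseˡ y))
                                        (trans (to-cong (≡.sym eq)) (strictlyInverseˡ x))) in
    punchOut x≢y , trans (to-cong (Fin.punchIn-punchOut x≢y)) (strictlyInverseˡ y)
  where
  open Inverse size
  open Setoid S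
  identity = Identity.inverse (≡.setoid (Fin n))

hasSize-empty : {S : Setoid a ℓ} → ¬ Setoid.Carrier S → HasSize S 0
hasSize-empty empty = record
  { to        = λ ()
  ; from      = λ x → contradiction x empty
  ; to-cong   = λ { {()} }
  ; from-cong = λ {x} _ → contradiction x empty
  ; inverse   = (λ { {x} _ → contradiction x empty }) , (λ { {()} })
  }

-- Finite fields and Fermat's theorem.

module FiniteFieldProperties {q : ℕ} (F : FiniteField q c ℓ) where
  open FiniteField F hiding (zero)
  open Exp commutativeSemiring public renaming (_^_ to _^ᶠ_)
  open SetoidReasoning setoid

  infix 4 _≟_

  _≟_ : Decidable _≈_
  x ≟ y = map′ (λ eq → trans (sym (strictlyInverseˡ x)) (trans (to-cong eq) (strictlyInverseˡ y)))
               from-cong (from x Fin.≟ from y)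
    where open Inverse size

  *-cancelˡ : ∀ {k x y} → ¬ k ≈ 0# → k * x ≈ k * y → x ≈ y
  *-cancelˡ {k} {x} {y} k≉0 kx≈ky with k⁻¹ , k⁻¹k≈1 , _ ← invertible k≉0 = begin
    x              ≈⟨ *-identityˡ x ⟨
    1# * x         ≈⟨ *-congʳ k⁻¹k≈1 ⟨
    k⁻¹ * k * x    ≈⟨ *-assoc _ _ _ ⟩
    k⁻¹ * (k * x)  ≈⟨ *-congˡ kx≈ky ⟩
    k⁻¹ * (k * y)  ≈⟨ *-assoc _ _ _ ⟨
    k⁻¹ * k * y    ≈⟨ *-congʳ k⁻¹k≈1 ⟩
    1# * y         ≈⟨ *-identityˡ y ⟩
    y              ∎

  *-≉0 : ∀ {x y} → ¬ x ≈ 0# → ¬ y ≈ 0# → ¬ x * y ≈ 0#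
  *-≉0 x≉0 y≉0 xy≈0 = y≉0 (*-cancelˡ x≉0 (trans xy≈0 (sym (zeroʳ _))))

  1≉0 : ¬ 1# ≈ 0#
  1≉0 = 0≉1 ∘ sym

  inverse≉0 : ∀ {x y} → x * y ≈ 1# → ¬ x ≈ 0#
  inverse≉0 xy≈1 x≈0 = 0≉1 (trans (sym (zeroˡ _)) (trans (*-congʳ (sym x≈0)) xy≈1))

  units : Setoid _ _
  units = setoid -ₛ 0#

  units-size : HasSize units (q ∸ 1)
  units-size = hasSize-- size 0#

  -- Multiplication by x permutes the units, so their product P satisfies
  -- P ≈ x ^ (q ∸ 1) * P.
  unit-power : ∀ {x} → ¬ x ≈ 0# → x ^ᶠ (q ∸ 1) ≈ 1#
  unit-power {x} x≉0 = *-cancelˡ (product≉0 unit (proj₂ ∘ to)) (begin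
    product unit * x ^ᶠ (q ∸ 1)
      ≈⟨ *-comm _ _ ⟩
    x ^ᶠ (q ∸ 1) * product unit
      ≈⟨ *-congʳ (Π.sum-replicate (q ∸ 1)) ⟨
    product {q ∸ 1} (λ _ → x) * product unit
      ≈⟨ Π.∑-distrib-+ (λ _ → x) unit ⟨
    product (λ i → x * unit i)
      ≈⟨ Π.sum-cong-≋ (λ i → strictlyInverseˡ (Inverse.to multiplication (to i))) ⟨
    product (λ i → unit (Inverse.to permutation i))
      ≈⟨ Π.sum-permute unit permutation ⟨
    product unit
      ≈⟨ *-identityʳ _ ⟨
    product unit * 1#
      ∎)
    where
    open Inverse units-size
    module Π = CommutativeMonoidSum *-commutativeMonoid
    open Π using () renaming (sum to product)
    unit : Fin (q ∸ 1) → Carrier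
    unit = proj₁ ∘ to
    cancel : ∀ {u v y z} → u * v ≈ 1# → y ≈ v * z → u * y ≈ z
    cancel uv≈1 y≈vz = trans (*-congˡ y≈vz) (trans (sym (*-assoc _ _ _)) (trans (*-congʳ uv≈1) (*-identityˡ _)))
    multiplication : Inverse units units
    multiplication with x⁻¹ , x⁻¹x≈1 , xx⁻¹≈1 ← invertible x≉0 = record
      { to        = λ (y , y≉0) → x * y , *-≉0 x≉0 y≉0
      ; from      = λ (y , y≉0) → x⁻¹ * y , *-≉0 (inverse≉0 x⁻¹x≈1) y≉0
      ; to-cong   = *-congˡ
      ; from-cong = *-congˡ
      ; inverse   = cancel xx⁻¹≈1 , cancel x⁻¹x≈1
      }
    permutation = units-size ⟨∘⟩ (multiplication ⟨∘⟩ flip units-size)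
    product≉0 : ∀ {n} (f : Fin n → Carrier) → (∀ i → ¬ f i ≈ 0#) → ¬ product f ≈ 0#
    product≉0 {zero}  f f≉0 = 1≉0
    product≉0 {suc n} f f≉0 = *-≉0 (f≉0 0F) (product≉0 (f ∘ suc) (f≉0 ∘ suc))

  fermat : ∀ x → x ^ᶠ q ≈ x
  fermat x = trans (^-congʳ x (≡.sym q≡1+[q-1])) (power (x ≟ 0#))
    where
    -- The index of `0#` makes `q` positive, so the truncated `q ∸ 1` is a true predecessor.
    q≡1+[q-1] : suc (q ∸ 1) ≡ q
    q≡1+[q-1] = ℕ.suc-pred q {{Fin.nonZeroIndex (Inverse.from size 0#)}}
    power : Dec (x ≈ 0#) → x ^ᶠ suc (q ∸ 1) ≈ x
    power (yes x≈0) = trans (*-congʳ x≈0) (trans (zeroˡ _) (sym x≈0))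
    power (no x≉0)  = trans (*-congˡ (unit-power x≉0)) (*-identityʳ x)

-- Characteristic 2: square roots and computation modulo 2.

module EvenFieldProperties {q : ℕ} (F : FiniteField q c ℓ) (2∣q : 2 ∣ q) where
  open FiniteField F hiding (zero)
  open FiniteFieldProperties F public
  open RingProperties ring using (-‿distribˡ-*; -‿involutive; -0#≈0#)
  open SetoidReasoning setoid

  private
    q/2 = _∣_.quotient 2∣q

  -- Since `x ^ᶠ q ≈ x`, the power `q/2` inverts squaring; being a power, it is also multiplicative.
  sqrt : Carrier → Carrier
  sqrt x = x ^ᶠ q/2

  sqrt-square : ∀ x → sqrt x * sqrt x ≈ x
  sqrt-square x = begin
    sqrt x * sqrt x    ≈⟨ *-congˡ (*-identityʳ _) ⟨
    sqrt x ^ᶠ 2        ≈⟨ ^-assocʳ x q/2 2 ⟩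
    x ^ᶠ (q/2 ℕ.* 2)   ≈⟨ ^-congʳ x (_∣_.equality 2∣q) ⟨
    x ^ᶠ q             ≈⟨ fermat x ⟩
    x                  ∎

  -- Both - 1# and 1# are recovered from the square root of their common square.
  -1≈1 : - 1# ≈ 1#
  -1≈1 = begin
    - 1#                       ≈⟨ sqrt-square (- 1#) ⟨
    sqrt (- 1#) * sqrt (- 1#)  ≈⟨ ^-distrib-* (- 1#) (- 1#) q/2 ⟨
    sqrt (- 1# * - 1#)         ≈⟨ ^-congˡ q/2 (-‿distribˡ-* 1# (- 1#)) ⟨
    sqrt (- (1# * - 1#))       ≈⟨ ^-congˡ q/2 (-‿cong (*-identityˡ (- 1#))) ⟩
    sqrt (- - 1#)              ≈⟨ ^-congˡ q/2 (-‿involutive 1#) ⟩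
    sqrt 1#                    ≈⟨ ^-congˡ q/2 (*-identityˡ 1#) ⟨
    sqrt (1# * 1#)             ≈⟨ ^-distrib-* 1# 1# q/2 ⟩
    sqrt 1# * sqrt 1#          ≈⟨ sqrt-square 1# ⟩
    1#                         ∎

  x+x≈0 : ∀ x → x + x ≈ 0#
  x+x≈0 x = begin
    x + x              ≈⟨ +-cong (*-identityˡ x) (*-identityˡ x) ⟨
    1# * x + 1# * x    ≈⟨ +-congˡ (*-congʳ -1≈1) ⟨
    1# * x + - 1# * x  ≈⟨ distribʳ x 1# (- 1#) ⟨
    (1# - 1#) * x      ≈⟨ *-congʳ (-‿inverseʳ 1#) ⟩
    0# * x             ≈⟨ zeroˡ x ⟩
    0#                 ∎

  private
    𝔽₂ : RawRing _ _
    𝔽₂ = record { _≈_ = _≡_ ; _+_ = _xor_ ; _*_ = _∧_ ; -_ = id ; 0# = false ; 1# = true }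

    fromBool : Bool → Carrier
    fromBool false = 0#
    fromBool true  = 1#

    𝔽₂→F : 𝔽₂ -Raw-AlmostCommutative⟶ fromCommutativeRing commutativeRing
    𝔽₂→F = record
      { ⟦_⟧    = fromBool
      ; +-homo = λ where
          false _     → sym (+-identityˡ _)
          true  false → sym (+-identityʳ _)
          true  true  → sym (x+x≈0 1#)
      ; *-homo = λ where
          false _ → sym (zeroˡ _)
          true  _ → sym (*-identityˡ _)
      ; -‿homo = λ where
          false → sym -0#≈0#
          true  → sym -1≈1
      ; 0-homo = refl
      ; 1-homo = refl
      }

    _≟ᵇ_ : (x y : Bool) → Maybe (fromBool x ≈ fromBool y)
    false ≟ᵇ false = just refl
    true  ≟ᵇ true  = just refl
    _     ≟ᵇ _     = nothing

  -- The coefficients are Booleans, so polynomials are normalised modulo 2.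
  open RingSolver 𝔽₂ (fromCommutativeRing commutativeRing) 𝔽₂→F _≟ᵇ_
    public using (solve; con; _:=_; _:+_; _:*_; _:-_; _:×_; Polynomial)

-- Quadratic forms in characteristic 2: substitution, nucleus and discriminant.

module ConicProperties {q : ℕ} (F : FiniteField q c ℓ) (2∣q : 2 ∣ q) where
  open Vector using ([]; _∷_; foldr)
  open FiniteField F hiding (zero)
  open EvenFieldProperties F 2∣q public
  open Projective F
  open Hyperplanes F
  open RawMonoidDefs +-rawMonoid using () renaming (_×_ to _•_)
  open CommutativeSemigroupProperties *-commutativeSemigroup using (interchange)
  open SemiringSum semiring using (sum-cong-≋; *-distribˡ-sum; *-distribʳ-sum; ∑-comm)
  open SetoidReasoning setoid

  private
    variable
      n k : ℕ

  infix  4 _≋_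
  infixl 7 _⊙_ _◃_
  infixl 8 _·_

  _≋_ : Vector Carrier n → Vector Carrier n → Set _
  u ≋ v = ∀ i → u i ≈ v i

  _·_ : Vector Carrier n → Vector Carrier n → Carrier
  u · v = sum (λ i → u i * v i)

  ·-cong : {u u′ v v′ : Vector Carrier n} → u ≋ u′ → v ≋ v′ → u · v ≈ u′ · v′
  ·-cong u≋u′ v≋v′ = sum-cong-≋ (λ i → *-cong (u≋u′ i) (v≋v′ i))

  ·-scaleˡ : ∀ x (u v : Vector Carrier n) → (λ i → x * u i) · v ≈ x * u · v
  ·-scaleˡ x u v = trans (sum-cong-≋ (λ i → *-assoc x (u i) (v i))) (sym (*-distribˡ-sum x (λ i → u i * v i)))

  ·-scaleʳ : ∀ x (u v : Vector Carrier n) → u · (λ i → x * v i) ≈ x * u · v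
  ·-scaleʳ x u v = trans (sum-cong-≋ (λ i → *-comm (u i) (x * v i)))
    (trans (·-scaleˡ x v u) (*-congˡ (sum-cong-≋ (λ i → *-comm (v i) (u i)))))

  ·-assoc : (u : Vector Carrier n) (M : Fin n → Fin k → Carrier) (v : Vector Carrier k) →
    (λ j → u · (λ i → M i j)) · v ≈ u · (λ i → M i · v)
  ·-assoc u M v = begin
    sum (λ j → sum (λ i → u i * M i j) * v j)    ≈⟨ sum-cong-≋ (λ j → *-distribʳ-sum (v j) (λ i → u i * M i j)) ⟩
    sum (λ j → sum (λ i → u i * M i j * v j))    ≈⟨ ∑-comm (λ j i → u i * M i j * v j) ⟩
    sum (λ i → sum (λ j → u i * M i j * v j))    ≈⟨ sum-cong-≋ (λ i → sum-cong-≋ (λ j → *-assoc (u i) (M i j) (v j))) ⟩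
    sum (λ i → sum (λ j → u i * (M i j * v j)))  ≈⟨ sum-cong-≋ (λ i → *-distribˡ-sum (u i) (λ j → M i j * v j)) ⟨
    sum (λ i → u i * M i · v)                    ∎

  _⊙_ : LinearForm → Matrix → LinearForm
  (l ⊙ A) j = l · (λ i → A i j)

  -- The pairs i ≤ j indexing the coefficients of a quadratic form, in order.
  row col : Fin 6 → Fin 3
  row = 0F ∷ 0F ∷ 0F ∷ 1F ∷ 1F ∷ 2F ∷ []
  col = 0F ∷ 1F ∷ 2F ∷ 1F ∷ 2F ∷ 2F ∷ []

  -- The form a (A X).
  _◃_ : QuadraticForm → Matrix → QuadraticForm
  (a ◃ A) k = a · (λ t → (A (row t) ⊗ A (col t)) k)

  -- The superscript ᵖ marks the counterpart on formal polynomials, for the ring solver.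
  Σᵖ : Vector (Polynomial n) k → Polynomial n
  Σᵖ = foldr _:+_ (con false)

  infixl 8 _·ᵖ_ _⊗ᵖ_

  _·ᵖ_ : Vector (Polynomial n) k → Vector (Polynomial n) k → Polynomial n
  u ·ᵖ v = Σᵖ (λ i → u i :* v i)

  _⊗ᵖ_ : Vector (Polynomial n) 3 → Vector (Polynomial n) 3 → Vector (Polynomial n) 6
  l ⊗ᵖ m = l 0F :* m 0F
         ∷ l 0F :* m 1F :+ l 1F :* m 0F
         ∷ l 0F :* m 2F :+ l 2F :* m 0F
         ∷ l 1F :* m 1F
         ∷ l 1F :* m 2F :+ l 2F :* m 1F
         ∷ l 2F :* m 2F
         ∷ []

  -- With a column of a matrix as `x`, this gives the coefficients of squares in `⊗-◃`.
  ⊗-square : ∀ (l m x : LinearForm) →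
    (l ⊗ m) · (λ t → x (row t) * x (col t)) ≈ (l · x) * (m · x)
  ⊗-square l m x = solve 9
    (λ l₀ l₁ l₂ m₀ m₁ m₂ x₀ x₁ x₂ →
      let l = l₀ ∷ l₁ ∷ l₂ ∷ []; m = m₀ ∷ m₁ ∷ m₂ ∷ []; x = x₀ ∷ x₁ ∷ x₂ ∷ [] in
      (l ⊗ᵖ m) ·ᵖ (λ t → x (row t) :* x (col t)) := (l ·ᵖ x) :* (m ·ᵖ x))
    refl (l 0F) (l 1F) (l 2F) (m 0F) (m 1F) (m 2F) (x 0F) (x 1F) (x 2F)

  -- The polarisation of `⊗-square`; with two columns of a matrix as `x` and `y`, it gives the mixed
  -- coefficients in `⊗-◃`.
  ⊗-polar : ∀ (l m x y : LinearForm) →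
    (l ⊗ m) · (λ t → x (row t) * y (col t) + y (row t) * x (col t))
      ≈ (l · x) * (m · y) + (l · y) * (m · x)
  ⊗-polar l m x y = solve 12
    (λ l₀ l₁ l₂ m₀ m₁ m₂ x₀ x₁ x₂ y₀ y₁ y₂ →
      let l = l₀ ∷ l₁ ∷ l₂ ∷ []; m = m₀ ∷ m₁ ∷ m₂ ∷ []
          x = x₀ ∷ x₁ ∷ x₂ ∷ []; y = y₀ ∷ y₁ ∷ y₂ ∷ [] in
      (l ⊗ᵖ m) ·ᵖ (λ t → x (row t) :* y (col t) :+ y (row t) :* x (col t))
        := (l ·ᵖ x) :* (m ·ᵖ y) :+ (l ·ᵖ y) :* (m ·ᵖ x))
    refl (l 0F) (l 1F) (l 2F) (m 0F) (m 1F) (m 2F) (x 0F) (x 1F) (x 2F) (y 0F) (y 1F) (y 2F)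

  ⊗-◃ : ∀ l m A → (l ⊗ m) ◃ A ≋ (l ⊙ A) ⊗ (m ⊙ A)
  ⊗-◃ l m A 0F = ⊗-square l m (λ i → A i 0F)
  ⊗-◃ l m A 1F = ⊗-polar l m (λ i → A i 0F) (λ i → A i 1F)
  ⊗-◃ l m A 2F = ⊗-polar l m (λ i → A i 0F) (λ i → A i 2F)
  ⊗-◃ l m A 3F = ⊗-square l m (λ i → A i 1F)
  ⊗-◃ l m A 4F = ⊗-polar l m (λ i → A i 1F) (λ i → A i 2F)
  ⊗-◃ l m A 5F = ⊗-square l m (λ i → A i 2F)

  -- `a ◃ A` is a linear combination of products of rows of `A`, so it suffices to substitute `B`
  -- into such products, which is `⊗-◃`; the rows of `A ⊡ B` are `A i ⊙ B`.
  ◃-◃ : ∀ a A B → (a ◃ A) ◃ B ≋ a ◃ (A ⊡ B)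
  ◃-◃ a A B k = trans
    (·-assoc a (λ t → A (row t) ⊗ A (col t)) (λ t → (B (row t) ⊗ B (col t)) k))
    (·-cong {u = a} (λ _ → refl) (λ t → ⊗-◃ (A (row t)) (A (col t)) B k))

  ⊗-cong : {l l′ m m′ : LinearForm} → l ≋ l′ → m ≋ m′ → l ⊗ m ≋ l′ ⊗ m′
  ⊗-cong l≋l′ m≋m′ 0F = *-cong (l≋l′ 0F) (m≋m′ 0F)
  ⊗-cong l≋l′ m≋m′ 1F = +-cong (*-cong (l≋l′ 0F) (m≋m′ 1F)) (*-cong (l≋l′ 1F) (m≋m′ 0F))
  ⊗-cong l≋l′ m≋m′ 2F = +-cong (*-cong (l≋l′ 0F) (m≋m′ 2F)) (*-cong (l≋l′ 2F) (m≋m′ 0F))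
  ⊗-cong l≋l′ m≋m′ 3F = *-cong (l≋l′ 1F) (m≋m′ 1F)
  ⊗-cong l≋l′ m≋m′ 4F = +-cong (*-cong (l≋l′ 1F) (m≋m′ 2F)) (*-cong (l≋l′ 2F) (m≋m′ 1F))
  ⊗-cong l≋l′ m≋m′ 5F = *-cong (l≋l′ 2F) (m≋m′ 2F)

  ⊗-comm : ∀ (l m : LinearForm) → l ⊗ m ≋ m ⊗ l
  ⊗-comm l m 0F = *-comm _ _
  ⊗-comm l m 1F = trans (+-comm _ _) (+-cong (*-comm _ _) (*-comm _ _))
  ⊗-comm l m 2F = trans (+-comm _ _) (+-cong (*-comm _ _) (*-comm _ _))
  ⊗-comm l m 3F = *-comm _ _
  ⊗-comm l m 4F = trans (+-comm _ _) (+-cong (*-comm _ _) (*-comm _ _))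
  ⊗-comm l m 5F = *-comm _ _

  ⊙-cong : {l l′ : LinearForm} → l ≋ l′ → ∀ A → l ⊙ A ≋ l′ ⊙ A
  ⊙-cong l≋l′ A j = ·-cong l≋l′ (λ i → refl {x = A i j})

  ◃-cong : {a b : QuadraticForm} → a ≋ b → ∀ A → a ◃ A ≋ b ◃ A
  ◃-cong a≋b A k = ·-cong a≋b (λ t → refl {x = (A (row t) ⊗ A (col t)) k})

  ◃-scale : ∀ x a A → (λ i → x * a i) ◃ A ≋ (λ i → x * (a ◃ A) i)
  ◃-scale x a A k = ·-scaleˡ x a (λ t → (A (row t) ⊗ A (col t)) k)

  ◃-∼ : ∀ {a b} A → a ∼ b → a ◃ A ∼ b ◃ A
  ◃-∼ {b = b} A (k , k≉0 , a≋kb) =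
    k , k≉0 , λ i → trans (◃-cong a≋kb A i) (◃-scale k b A i)

  ⊙-∼ : ∀ {l m} A → l ∼ m → l ⊙ A ∼ m ⊙ A
  ⊙-∼ {m = m} A (k , k≉0 , l≋km) =
    k , k≉0 , λ i → trans (⊙-cong l≋km A i) (·-scaleˡ k m (λ j → A j i))

  ≋⇒∼ : {u v : Vector Carrier n} → u ≋ v → u ∼ v
  ≋⇒∼ u≋v = 1# , 1≉0 , λ i → trans (u≋v i) (sym (*-identityˡ _))

  identityᵖ : Fin 3 → Vector (Polynomial n) 3
  identityᵖ = (con true ∷ con false ∷ con false ∷ [])
            ∷ (con false ∷ con true ∷ con false ∷ [])
            ∷ (con false ∷ con false ∷ con true ∷ [])
            ∷ []

  ⊙-identity : ∀ l → l ⊙ identity ≋ l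
  ⊙-identity l = λ where
      0F → solve 3 (goal 0F) refl (l 0F) (l 1F) (l 2F)
      1F → solve 3 (goal 1F) refl (l 0F) (l 1F) (l 2F)
      2F → solve 3 (goal 2F) refl (l 0F) (l 1F) (l 2F)
    where
    goal : Fin 3 → N-ary 3 (Polynomial 3) (Polynomial 3 × Polynomial 3)
    goal j x y z = let l = x ∷ y ∷ z ∷ [] in l ·ᵖ (λ i → identityᵖ i j) := l j

  ◃-identity : ∀ a → a ◃ identity ≋ a
  ◃-identity a = λ where
      0F → solve 6 (goal 0F) refl (a 0F) (a 1F) (a 2F) (a 3F) (a 4F) (a 5F)
      1F → solve 6 (goal 1F) refl (a 0F) (a 1F) (a 2F) (a 3F) (a 4F) (a 5F)
      2F → solve 6 (goal 2F) refl (a 0F) (a 1F) (a 2F) (a 3F) (a 4F) (a 5F)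
      3F → solve 6 (goal 3F) refl (a 0F) (a 1F) (a 2F) (a 3F) (a 4F) (a 5F)
      4F → solve 6 (goal 4F) refl (a 0F) (a 1F) (a 2F) (a 3F) (a 4F) (a 5F)
      5F → solve 6 (goal 5F) refl (a 0F) (a 1F) (a 2F) (a 3F) (a 4F) (a 5F)
    where
    goal : Fin 6 → N-ary 6 (Polynomial 6) (Polynomial 6 × Polynomial 6)
    goal k a₀ a₁ a₂ a₃ a₄ a₅ = let a = a₀ ∷ a₁ ∷ a₂ ∷ a₃ ∷ a₄ ∷ a₅ ∷ [] in
      a ·ᵖ (λ t → (identityᵖ (row t) ⊗ᵖ identityᵖ (col t)) k) := a k

  ⊙-inverse : ∀ A B → (∀ i j → (A ⊡ B) i j ≈ identity i j) → ∀ l → l ⊙ A ⊙ B ≋ l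
  ⊙-inverse A B AB≈I l j = begin
    (l ⊙ A ⊙ B) j       ≈⟨ ·-assoc l A (λ i → B i j) ⟩
    (l ⊙ (A ⊡ B)) j     ≈⟨ ·-cong {u = l} (λ _ → refl) (λ i → AB≈I i j) ⟩
    (l ⊙ identity) j    ≈⟨ ⊙-identity l j ⟩
    l j                 ∎

  ⊙-∼⁻¹ : ∀ A B → (∀ i j → (A ⊡ B) i j ≈ identity i j) → ∀ {l m} → l ⊙ A ∼ m ⊙ A → l ∼ m
  ⊙-∼⁻¹ A B AB≈I {l} {m} lA∼mA = ∼-trans (≋⇒∼ (λ i → sym (⊙-inverse A B AB≈I l i)))
    (∼-trans (⊙-∼ B lA∼mA) (≋⇒∼ (⊙-inverse A B AB≈I m)))

  ◃-inverse : ∀ A B → (∀ i j → (A ⊡ B) i j ≈ identity i j) → ∀ a → a ◃ A ◃ B ≋ a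
  ◃-inverse A B AB≈I a k = begin
    (a ◃ A ◃ B) k     ≈⟨ ◃-◃ a A B k ⟩
    (a ◃ (A ⊡ B)) k   ≈⟨ ·-cong {u = a} (λ _ → refl) (λ t → ⊗-cong (AB≈I (row t)) (AB≈I (col t)) k) ⟩
    (a ◃ identity) k  ≈⟨ ◃-identity a k ⟩
    a k               ∎

  -- In characteristic 2 the polar form of a is alternating, and this vector spans its
  -- radical unless the polar form is zero.
  nucleus : QuadraticForm → LinearForm
  nucleus a = a 4F ∷ a 2F ∷ a 1F ∷ []

  nucleus-cong : ∀ {a b} → a ≋ b → nucleus a ≋ nucleus b
  nucleus-cong a≋b 0F = a≋b 4F
  nucleus-cong a≋b 1F = a≋b 2F
  nucleus-cong a≋b 2F = a≋b 1F

  -- The determinant, as signs are immaterial.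
  det : Matrix → Carrier
  det A = A 0F 0F * (A 1F 1F * A 2F 2F + A 1F 2F * A 2F 1F)
        + A 0F 1F * (A 1F 0F * A 2F 2F + A 1F 2F * A 2F 0F)
        + A 0F 2F * (A 1F 0F * A 2F 1F + A 1F 1F * A 2F 0F)

  -- The polar form of `a` at two vectors is the determinant of `nucleus a` and these vectors. For
  -- invertible `A`, substitution therefore replaces the nucleus by `det A` times its preimage under
  -- `A`; written without the inverse, this is a polynomial identity.
  nucleus-◃ : ∀ a A → (λ i → A i · nucleus (a ◃ A)) ≋ (λ i → det A * nucleus a i)
  nucleus-◃ a A = λ where
      0F → solve 15 (goal 0F) refl
        (a 0F) (a 1F) (a 2F) (a 3F) (a 4F) (a 5F) (A 0F 0F) (A 0F 1F) (A 0F 2F)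
        (A 1F 0F) (A 1F 1F) (A 1F 2F) (A 2F 0F) (A 2F 1F) (A 2F 2F)
      1F → solve 15 (goal 1F) refl
        (a 0F) (a 1F) (a 2F) (a 3F) (a 4F) (a 5F) (A 0F 0F) (A 0F 1F) (A 0F 2F)
        (A 1F 0F) (A 1F 1F) (A 1F 2F) (A 2F 0F) (A 2F 1F) (A 2F 2F)
      2F → solve 15 (goal 2F) refl
        (a 0F) (a 1F) (a 2F) (a 3F) (a 4F) (a 5F) (A 0F 0F) (A 0F 1F) (A 0F 2F)
        (A 1F 0F) (A 1F 1F) (A 1F 2F) (A 2F 0F) (A 2F 1F) (A 2F 2F)
    where
    goal : Fin 3 → N-ary 15 (Polynomial 15) (Polynomial 15 × Polynomial 15)
    goal i a₀ a₁ a₂ a₃ a₄ a₅ l₀ l₁ l₂ m₀ m₁ m₂ n₀ n₁ n₂ =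
      let a = a₀ ∷ a₁ ∷ a₂ ∷ a₃ ∷ a₄ ∷ a₅ ∷ []
          A = (l₀ ∷ l₁ ∷ l₂ ∷ []) ∷ (m₀ ∷ m₁ ∷ m₂ ∷ []) ∷ (n₀ ∷ n₁ ∷ n₂ ∷ []) ∷ []
          a◃A = λ k → a ·ᵖ (λ t → (A (row t) ⊗ᵖ A (col t)) k) in
      A i ·ᵖ (a◃A 4F ∷ a◃A 2F ∷ a◃A 1F ∷ [])
        := ( l₀ :* (m₁ :* n₂ :+ m₂ :* n₁)
          :+ l₁ :* (m₀ :* n₂ :+ m₂ :* n₀)
          :+ l₂ :* (m₀ :* n₁ :+ m₁ :* n₀)) :* (a₄ ∷ a₂ ∷ a₁ ∷ []) i

  square : LinearForm → Vector Carrier 6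
  square v t = v (row t) * v (col t)

  discriminant : QuadraticForm → Carrier
  discriminant a =
    4 • (a 0F * a 3F * a 5F) + a 1F * a 2F * a 4F
      - a 0F * (a 4F * a 4F) - a 3F * (a 2F * a 2F) - a 5F * (a 1F * a 1F)

  -- The value at the nucleus contains `a 1F * a 2F * a 4F` three times, of which one survives
  -- modulo 2; the multiple of 4 vanishes and signs do not matter.
  discriminant≈nucleus : ∀ a → discriminant a ≈ a · square (nucleus a)
  discriminant≈nucleus a = solve 6
    (λ a₀ a₁ a₂ a₃ a₄ a₅ →
      let n = a₄ ∷ a₂ ∷ a₁ ∷ [] in
      4 :× (a₀ :* a₃ :* a₅) :+ a₁ :* a₂ :* a₄
        :- a₀ :* (a₄ :* a₄) :- a₃ :* (a₂ :* a₂) :- a₅ :* (a₁ :* a₁)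
      := (a₀ ∷ a₁ ∷ a₂ ∷ a₃ ∷ a₄ ∷ a₅ ∷ []) ·ᵖ (λ t → n (row t) :* n (col t)))
    refl (a 0F) (a 1F) (a 2F) (a 3F) (a 4F) (a 5F)

  -- Evaluating `a ◃ A` at its nucleus means evaluating `a` at the image of that vector under `A`,
  -- which is `det A` times `nucleus a`; the form is quadratic, whence the square.
  discriminant-◃ : ∀ a A → discriminant (a ◃ A) ≈ det A * det A * discriminant a
  discriminant-◃ a A = begin
    discriminant (a ◃ A)
      ≈⟨ discriminant≈nucleus (a ◃ A) ⟩
    (a ◃ A) · square n′
      ≈⟨ ·-assoc a (λ t → A (row t) ⊗ A (col t)) (square n′) ⟩
    a · (λ t → (A (row t) ⊗ A (col t)) · square n′)
      ≈⟨ ·-cong {u = a} (λ _ → refl) (λ t → ⊗-square (A (row t)) (A (col t)) n′) ⟩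
    a · square (λ i → A i · n′)
      ≈⟨ ·-cong {u = a} (λ _ → refl) (λ t → trans (*-cong (nucleus-◃ a A (row t)) (nucleus-◃ a A (col t))) (interchange _ _ _ _)) ⟩
    a · (λ t → det A * det A * square (nucleus a) t)
      ≈⟨ ·-scaleʳ (det A * det A) a (square (nucleus a)) ⟩
    det A * det A * a · square (nucleus a)
      ≈⟨ *-congˡ (discriminant≈nucleus a) ⟨
    det A * det A * discriminant a
      ∎
    where n′ = nucleus (a ◃ A)

  -- Used with a matrix and with its inverse, this transfers vanishing both ways without a proof
  -- that `det A` is nonzero.
  discriminant-◃-zero : ∀ a A → discriminant a ≈ 0# → discriminant (a ◃ A) ≈ 0#
  discriminant-◃-zero a A Δ≈0 = trans (discriminant-◃ a A) (trans (*-congˡ Δ≈0) (zeroʳ _))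

  discriminant-cong : ∀ {a b} → a ≋ b → discriminant a ≈ discriminant b
  discriminant-cong {a} {b} a≋b = begin
    discriminant a              ≈⟨ discriminant≈nucleus a ⟩
    a · square (nucleus a)      ≈⟨ ·-cong a≋b (λ t → *-cong (nucleus-cong a≋b (row t)) (nucleus-cong a≋b (col t))) ⟩
    b · square (nucleus b)      ≈⟨ discriminant≈nucleus b ⟨
    discriminant b              ∎

  discriminant-scale : ∀ x a → discriminant (λ i → x * a i) ≈ x * (x * x) * discriminant a
  discriminant-scale x a = solve 7
    (λ a₀ a₁ a₂ a₃ a₄ a₅ x → let Δ = λ a₀ a₁ a₂ a₃ a₄ a₅ →
                                       4 :× (a₀ :* a₃ :* a₅) :+ a₁ :* a₂ :* a₄
                                         :- a₀ :* (a₄ :* a₄) :- a₃ :* (a₂ :* a₂) :- a₅ :* (a₁ :* a₁) in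
      Δ (x :* a₀) (x :* a₁) (x :* a₂) (x :* a₃) (x :* a₄) (x :* a₅)
        := x :* (x :* x) :* Δ a₀ a₁ a₂ a₃ a₄ a₅)
    refl (a 0F) (a 1F) (a 2F) (a 3F) (a 4F) (a 5F) x

  discriminant-∼ : ∀ {a b} → a ∼ b → discriminant a ≈ 0# → discriminant b ≈ 0#
  discriminant-∼ {a} {b} (k , k≉0 , a≈kb) Δa≈0 = *-cancelˡ (*-≉0 k≉0 (*-≉0 k≉0 k≉0)) (begin
    k * (k * k) * discriminant b  ≈⟨ discriminant-scale k b ⟨
    discriminant (λ i → k * b i)  ≈⟨ discriminant-cong a≈kb ⟨
    discriminant a                ≈⟨ Δa≈0 ⟩
    0#                            ≈⟨ zeroʳ _ ⟨
    k * (k * k) * 0#              ∎)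

  -- The nucleus of a product is the cross product of its factors, so both factors vanish there.
  discriminant-⊗ : ∀ l m → discriminant (l ⊗ m) ≈ 0#
  discriminant-⊗ l m = trans (discriminant≈nucleus (l ⊗ m)) (solve 6
    (λ l₀ l₁ l₂ m₀ m₁ m₂ →
      let a = (l₀ ∷ l₁ ∷ l₂ ∷ []) ⊗ᵖ (m₀ ∷ m₁ ∷ m₂ ∷ [])
          n = a 4F ∷ a 2F ∷ a 1F ∷ [] in
      a ·ᵖ (λ t → n (row t) :* n (col t)) := con false)
    refl (l 0F) (l 1F) (l 2F) (m 0F) (m 1F) (m 2F))

  -- This makes the action on points adjoint to `◃`. The left side is the bilinear form of the
  -- symmetric matrix at two rows of `A`, and symmetry merges its mixed terms into the coefficients
  -- of `A i ⊗ A j`.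
  ⊡-symMatrix : ∀ A y i j → (A ⊡ symMatrix y ⊡ A ᵀ) i j ≈ (A i ⊗ A j) · y
  ⊡-symMatrix A y i j = solve 12
    (λ l₀ l₁ l₂ m₀ m₁ m₂ y₀ y₁ y₂ y₃ y₄ y₅ →
      let l = l₀ ∷ l₁ ∷ l₂ ∷ []
          m = m₀ ∷ m₁ ∷ m₂ ∷ []
          S = (y₀ ∷ y₁ ∷ y₂ ∷ []) ∷ (y₁ ∷ y₃ ∷ y₄ ∷ []) ∷ (y₂ ∷ y₄ ∷ y₅ ∷ []) ∷ [] in
      (λ k → l ·ᵖ (λ h → S h k)) ·ᵖ m := (l ⊗ᵖ m) ·ᵖ (y₀ ∷ y₁ ∷ y₂ ∷ y₃ ∷ y₄ ∷ y₅ ∷ []))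
    refl (A i 0F) (A i 1F) (A i 2F) (A j 0F) (A j 1F) (A j 2F)
         (y 0F) (y 1F) (y 2F) (y 3F) (y 4F) (y 5F)

  symMatrix-entry : ∀ y t → symMatrix y (row t) (col t) ≡ y t
  symMatrix-entry y 0F = ≡.refl
  symMatrix-entry y 1F = ≡.refl
  symMatrix-entry y 2F = ≡.refl
  symMatrix-entry y 3F = ≡.refl
  symMatrix-entry y 4F = ≡.refl
  symMatrix-entry y 5F = ≡.refl

-- Hyperplanes through the line and normal forms of their conics.

module NormalForms {q : ℕ} (F : FiniteField q c ℓ) (2∣q : 2 ∣ q) where
  open Vector using ([]; _∷_)
  open FiniteField F hiding (zero)
  open ConicProperties F 2∣q
  open Projective F
  open Hyperplanes F
  open GroupProperties +-group using () renaming (∙-cancelˡ to +-cancelˡ)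
  open SetoidReasoning setoid

  private
    variable
      n : ℕ

  ≉0-entry : {v : Vector Carrier n} → ¬ (v ≋ λ _ → 0#) → ∃[ i ] ¬ v i ≈ 0#
  ≉0-entry {v = v} v≉0 = Fin.¬∀⟶∃¬ _ _ (λ i → v i ≟ 0#) v≉0

  sum-zero : {v : Vector Carrier n} → v ≋ (λ _ → 0#) → sum v ≈ 0#
  sum-zero {zero}  v≈0 = refl
  sum-zero {suc n} v≈0 = trans (+-cong (v≈0 0F) (sum-zero (v≈0 ∘ suc))) (+-identityˡ 0#)

  ·-zeroˡ : {u : Vector Carrier n} → u ≋ (λ _ → 0#) → ∀ v → u · v ≈ 0#
  ·-zeroˡ u≈0 v = sum-zero (λ i → trans (*-congʳ (u≈0 i)) (zeroˡ (v i)))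

  ·-zeroʳ : ∀ u {v : Vector Carrier n} → v ≋ (λ _ → 0#) → u · v ≈ 0#
  ·-zeroʳ u v≈0 = sum-zero (λ i → trans (*-congˡ (v≈0 i)) (zeroʳ (u i)))

  ◃-≉0 : ∀ A B → (∀ i j → (A ⊡ B) i j ≈ identity i j) →
    ∀ {a} → ¬ (a ≋ λ _ → 0#) → ¬ (a ◃ A ≋ λ _ → 0#)
  ◃-≉0 A B AB≈I {a} a≉0 a◃A≈0 = a≉0 (λ i →
    trans (sym (◃-inverse A B AB≈I a i)) (·-zeroˡ a◃A≈0 (λ t → (B (row t) ⊗ B (col t)) i)))

  -- The minors at a nonzero entry `u i` give `v` as `v i / u i` times `u`; if `v i` vanished, so
  -- would all of `v`.
  minors⇒∼ : {u v : Vector Carrier n} → ¬ (u ≋ λ _ → 0#) → ¬ (v ≋ λ _ → 0#) →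
    (∀ i j → u i * v j ≈ u j * v i) → u ∼ v
  minors⇒∼ {u = u} {v} u≉0 v≉0 minors with i , uᵢ≉0 ← ≉0-entry u≉0 = ∼-sym
    (vᵢ * uᵢ⁻¹ , *-≉0 vᵢ≉0 (inverse≉0 (proj₁ (proj₂ (invertible uᵢ≉0)))) , λ j → *-cancelˡ uᵢ≉0 (begin
      u i * v j               ≈⟨ minors i j ⟩
      u j * vᵢ                ≈⟨ *-identityˡ _ ⟨
      1# * (u j * vᵢ)         ≈⟨ *-congʳ (proj₂ (proj₂ (invertible uᵢ≉0))) ⟨
      u i * uᵢ⁻¹ * (u j * vᵢ) ≈⟨ solve 4 (λ x y z w → x :* y :* (z :* w) := x :* (w :* y :* z)) refl (u i) uᵢ⁻¹ (u j) vᵢ ⟩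
      u i * (vᵢ * uᵢ⁻¹ * u j) ∎))
    where
    vᵢ = v i
    uᵢ⁻¹ = proj₁ (invertible uᵢ≉0)
    vᵢ≉0 : ¬ vᵢ ≈ 0#
    vᵢ≉0 vᵢ≈0 = v≉0 (λ j → *-cancelˡ uᵢ≉0 (trans (minors i j) (trans (*-congˡ vᵢ≈0) (trans (zeroʳ _) (sym (zeroʳ _))))))

  -- The representative line is spanned by `e₀` and `e₄`. By adjointness, incidence of `a` with
  -- their images under `A` is incidence of `a ◃ A` with `e₀` and `e₄` themselves, which singles out
  -- two coefficients.
  Contains⇒ : ∀ g L → points L ≐ g ∙ representative₈,₃ → ∀ H → Contains H L →
    (proj₁ H ◃ proj₁ g) 0F ≈ 0# × (proj₁ H ◃ proj₁ g) 4F ≈ 0#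
  Contains⇒ (A , A⁻¹) L (_ , A∙rep⊆L) (a , a≉0) L⊆H =
      trans (sym (solve 6
          (λ a₀ a₁ a₂ a₃ a₄ a₅ → (a₀ ∷ a₁ ∷ a₂ ∷ a₃ ∷ a₄ ∷ a₅ ∷ [])
            ·ᵖ (con true ∷ con false ∷ con false ∷ con false ∷ con false ∷ con false ∷ []) := a₀)
          refl (a′ 0F) (a′ 1F) (a′ 2F) (a′ 3F) (a′ 4F) (a′ 5F)))
        (vanishes (e₀ , λ e₀≈0 → 1≉0 (e₀≈0 0F))
          ((1# ∷ 0# ∷ [] , λ v≈0 → 1≉0 (v≈0 0F)) , 1# , 1≉0 , λ i j → sym (*-identityˡ (symMatrix e₀ i j))))
    , trans (sym (solve 6
          (λ a₀ a₁ a₂ a₃ a₄ a₅ → (a₀ ∷ a₁ ∷ a₂ ∷ a₃ ∷ a₄ ∷ a₅ ∷ [])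
            ·ᵖ (con false ∷ con false ∷ con false ∷ con false ∷ con true ∷ con false ∷ []) := a₄)
          refl (a′ 0F) (a′ 1F) (a′ 2F) (a′ 3F) (a′ 4F) (a′ 5F)))
        (vanishes (e₄ , λ e₄≈0 → 1≉0 (e₄≈0 4F))
          ((0# ∷ 1# ∷ [] , λ v≈0 → 1≉0 (v≈0 1F)) , 1# , 1≉0 , λ i j → sym (*-identityˡ (symMatrix e₄ i j))))
    where
    a′ = a ◃ A
    e₀ e₄ : Vector Carrier 6
    e₀ = 1# ∷ 0# ∷ 0# ∷ 0# ∷ 0# ∷ 0# ∷ []
    e₄ = 0# ∷ 0# ∷ 0# ∷ 0# ∷ 1# ∷ 0# ∷ []
    vanishes : ∀ Q → Q ∈ representative₈,₃ → a′ · proj₁ Q ≈ 0#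
    vanishes (e , e≉0) e∈rep = trans (·-assoc a (λ t → A (row t) ⊗ A (col t)) e) (a·y≈0 (Fin.all? (λ i → y i ≟ 0#)))
      where
      y : Vector Carrier 6
      y t = (A (row t) ⊗ A (col t)) · e
      -- When y vanishes it is not a point, but then a · y ≈ 0 is trivial.
      a·y≈0 : Dec (∀ i → y i ≈ 0#) → a · y ≈ 0#
      a·y≈0 (yes y≈0) = ·-zeroʳ a y≈0
      a·y≈0 (no y≉0)  = L⊆H (y , y≉0) (A∙rep⊆L {y , y≉0}
        ((e , e≉0) , e∈rep , 1# , 1≉0 , λ i j → trans (entry i j) (trans (sym (⊡-symMatrix A e i j)) (sym (*-identityˡ _)))))
        where
        -- `y` lists only the entries on and above the diagonal; those below need the factors
        -- exchanged.
        flipped : ∀ i j → (A i ⊗ A j) · e ≈ (A j ⊗ A i) · e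
        flipped i j = ·-cong {v = e} (⊗-comm (A i) (A j)) (λ _ → refl)
        entry : ∀ i j → symMatrix y i j ≈ (A i ⊗ A j) · e
        entry 0F 0F = refl
        entry 0F 1F = refl
        entry 0F 2F = refl
        entry 1F 0F = flipped 0F 1F
        entry 1F 1F = refl
        entry 1F 2F = refl
        entry 2F 0F = flipped 0F 2F
        entry 2F 1F = flipped 1F 2F
        entry 2F 2F = refl

  ⇒Contains : ∀ g L → points L ≐ g ∙ representative₈,₃ → ∀ H →
    (proj₁ H ◃ proj₁ g) 0F ≈ 0# → (proj₁ H ◃ proj₁ g) 4F ≈ 0# → Contains H L
  ⇒Contains (A , A⁻¹) L (L⊆A∙rep , _) (a , a≉0) a′₀≈0 a′₄≈0 (y , y≉0) y∈L
    with (x , x≉0) , (v , k , k≉0 , x≈kN) , m , m≉0 , y≈mAxAᵀ ← L⊆A∙rep {y , y≉0} y∈L = begin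
      a · y                                           ≈⟨ ·-cong {u = a} (λ _ → refl) y≋ ⟩
      a · (λ t → m * (A (row t) ⊗ A (col t)) · x)     ≈⟨ ·-scaleʳ m a (λ t → (A (row t) ⊗ A (col t)) · x) ⟩
      m * a · (λ t → (A (row t) ⊗ A (col t)) · x)     ≈⟨ *-congˡ (·-assoc a (λ t → A (row t) ⊗ A (col t)) x) ⟨
      m * (a ◃ A) · x                                 ≈⟨ *-congˡ (sum-zero terms) ⟩
      m * 0#                                          ≈⟨ zeroʳ m ⟩
      0#                                              ∎
    where
    y≋ : ∀ t → y t ≈ m * (A (row t) ⊗ A (col t)) · x
    y≋ t = trans (reflexive (≡.sym (symMatrix-entry y t)))
      (trans (y≈mAxAᵀ (row t) (col t)) (*-congˡ (⊡-symMatrix A x (row t) (col t))))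
    k*0 : ∀ {u z} → z ≈ k * 0# → u * z ≈ 0#
    k*0 z≈k0 = trans (*-congˡ (trans z≈k0 (zeroʳ k))) (zeroʳ _)
    -- On the representative line only the coordinates `0F` and `4F` can be nonzero, and there
    -- `a ◃ A` vanishes.
    terms : ∀ t → (a ◃ A) t * x t ≈ 0#
    terms 0F = trans (*-congʳ a′₀≈0) (zeroˡ _)
    terms 1F = k*0 (x≈kN 0F 1F)
    terms 2F = k*0 (x≈kN 0F 2F)
    terms 3F = k*0 (x≈kN 1F 1F)
    terms 4F = trans (*-congʳ a′₄≈0) (zeroˡ _)
    terms 5F = k*0 (x≈kN 2F 2F)

  -- Normalised representatives of PG(1,q): inj₁ s is (1 , s) and inj₂ _ is (0 , 1).
  Parameter : Setoid _ _
  Parameter = setoid ⊎.⊎ₛ ≡.setoid (Fin 1)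

  Parameter-size : HasSize Parameter (q ℕ.+ 1)
  Parameter-size = hasSize-⊎ size (Identity.inverse (≡.setoid (Fin 1)))

  open Setoid Parameter using () renaming (Carrier to Param; _≈_ to _≈ₚ_)

  -- The case b = c = 0, with (d , e) normalised.
  line-form : Param → QuadraticForm
  line-form (inj₁ s) = 0# ∷ 0# ∷ 0# ∷ 1# ∷ 0# ∷ s ∷ []
  line-form (inj₂ _) = 0# ∷ 0# ∷ 0# ∷ 0# ∷ 0# ∷ 1# ∷ []

  -- In the notation of the header, (b , c) = (1 , s) or (0 , 1), and the vectors
  -- complementary to (1 , s²) and (0 , 1) are (0 , 1) and (1 , 0).
  conic-form : Param × Carrier × Carrier → QuadraticForm
  conic-form (inj₁ s , t , w) = 0# ∷ 1# ∷ s ∷ t ∷ 0# ∷ t * (s * s) + w ∷ []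
  conic-form (inj₂ _ , t , w) = 0# ∷ 0# ∷ 1# ∷ w ∷ 0# ∷ t ∷ []

  private
    scale-1 : ∀ {k x y} → 1# ≈ k * 1# → x ≈ k * y → x ≈ y
    scale-1 1≈k x≈ky = trans x≈ky (trans (*-congʳ (sym (trans 1≈k (*-identityʳ _)))) (*-identityˡ _))

    1≉k0 : ∀ {k} → ¬ 1# ≈ k * 0#
    1≉k0 1≈k0 = 1≉0 (trans 1≈k0 (zeroʳ _))

    0≉k1 : ∀ {k} → ¬ k ≈ 0# → ¬ 0# ≈ k * 1#
    0≉k1 k≉0 0≈k1 = k≉0 (sym (trans 0≈k1 (*-identityʳ _)))

    rescale : ∀ {k} (k≉0 : ¬ k ≈ 0#) x → x ≈ k * (proj₁ (invertible k≉0) * x)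
    rescale k≉0 x with k⁻¹ , _ , kk⁻¹≈1 ← invertible k≉0 =
      sym (trans (sym (*-assoc _ _ _)) (trans (*-congʳ kk⁻¹≈1) (*-identityˡ x)))

    zero-entry : ∀ {k x} → x ≈ 0# → x ≈ k * 0#
    zero-entry x≈0 = trans x≈0 (sym (zeroʳ _))

    one-entry : ∀ {k} → k ≈ k * 1#
    one-entry = sym (*-identityʳ _)

  line-form-cong : ∀ {p p′} → p ≈ₚ p′ → line-form p ≋ line-form p′
  line-form-cong (⊎.inj₁ s≈s′) = λ where
    0F → refl
    1F → refl
    2F → refl
    3F → refl
    4F → refl
    5F → s≈s′
  line-form-cong (⊎.inj₂ _) = λ where
    0F → refl
    1F → refl
    2F → refl
    3F → refl
    4F → refl
    5F → refl

  -- Two forms of shape `inj₁` share the entry `1#`, which forces the scalar to be 1; for different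
  -- shapes `1#` faces `0#` at `3F`.
  line-form-injective : ∀ {p p′} → line-form p ∼ line-form p′ → p ≈ₚ p′
  line-form-injective {inj₁ s}  {inj₁ s′} (k , k≉0 , eq) = ⊎.inj₁ (scale-1 (eq 3F) (eq 5F))
  line-form-injective {inj₁ s}  {inj₂ _}  (k , k≉0 , eq) = contradiction (eq 3F) 1≉k0
  line-form-injective {inj₂ _}  {inj₁ s′} (k , k≉0 , eq) = contradiction (eq 3F) (0≉k1 k≉0)
  line-form-injective {inj₂ 0F} {inj₂ 0F} _              = ⊎.inj₂ ≡.refl

  -- The hypotheses leave only the entries at `3F` and `5F`; the first nonzero one is the scalar.
  line-form-surjective : ∀ {a} → ¬ (a ≋ λ _ → 0#) → a 0F ≈ 0# →
    nucleus a ≋ (λ _ → 0#) → ∃[ p ] a ∼ line-form p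
  line-form-surjective {a} a≉0 a₀≈0 n≈0 with a 3F ≟ 0# | a 5F ≟ 0#
  ... | no a₃≉0 | _ = inj₁ _ , a 3F , a₃≉0 , λ where
    0F → zero-entry a₀≈0
    1F → zero-entry (n≈0 2F)
    2F → zero-entry (n≈0 1F)
    3F → one-entry
    4F → zero-entry (n≈0 0F)
    5F → rescale a₃≉0 (a 5F)
  ... | yes a₃≈0 | no a₅≉0 = inj₂ 0F , a 5F , a₅≉0 , λ where
    0F → zero-entry a₀≈0
    1F → zero-entry (n≈0 2F)
    2F → zero-entry (n≈0 1F)
    3F → zero-entry a₃≈0
    4F → zero-entry (n≈0 0F)
    5F → one-entry
  ... | yes a₃≈0 | yes a₅≈0 = contradiction (λ where
    0F → a₀≈0
    1F → n≈0 2F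
    2F → n≈0 1F
    3F → a₃≈0
    4F → n≈0 0F
    5F → a₅≈0) a≉0

  xy+yx≈0 : ∀ x y → x * y + y * x ≈ 0#
  xy+yx≈0 x y = trans (+-congˡ (*-comm y x)) (x+x≈0 (x * y))

  nucleus-square : ∀ l → nucleus (l ⊗ l) ≋ (λ _ → 0#)
  nucleus-square l 0F = xy+yx≈0 (l 1F) (l 2F)
  nucleus-square l 1F = xy+yx≈0 (l 0F) (l 2F)
  nucleus-square l 2F = xy+yx≈0 (l 0F) (l 1F)

  -- Squaring is additive here, so X₁² + s X₂² is the square of X₁ + √s X₂.
  line-form-square : ∀ p → Σ[ l ∈ LinearForm ] line-form p ≋ l ⊗ l
  line-form-square (inj₁ s) = 0# ∷ 1# ∷ sqrt s ∷ [] , λ where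
    0F → sym (zeroˡ _)
    1F → sym (xy+yx≈0 _ _)
    2F → sym (xy+yx≈0 _ _)
    3F → sym (*-identityˡ _)
    4F → sym (xy+yx≈0 _ _)
    5F → sym (sqrt-square s)
  line-form-square (inj₂ _) = 0# ∷ 0# ∷ 1# ∷ [] , λ where
    0F → sym (zeroˡ _)
    1F → sym (xy+yx≈0 _ _)
    2F → sym (xy+yx≈0 _ _)
    3F → sym (zeroˡ _)
    4F → sym (xy+yx≈0 _ _)
    5F → sym (*-identityˡ _)

  line-form-nonzero : ∀ p → ¬ (line-form p ≋ λ _ → 0#)
  line-form-nonzero (inj₁ s) eq = 1≉0 (eq 3F)
  line-form-nonzero (inj₂ _) eq = 1≉0 (eq 5F)

  conic-form-cong : ∀ {p p′ t t′ w w′} → p ≈ₚ p′ → t ≈ t′ → w ≈ w′ →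
    conic-form (p , t , w) ≋ conic-form (p′ , t′ , w′)
  conic-form-cong (⊎.inj₁ s≈s′) t≈t′ w≈w′ = λ where
    0F → refl
    1F → refl
    2F → s≈s′
    3F → t≈t′
    4F → refl
    5F → +-cong (*-cong t≈t′ (*-cong s≈s′ s≈s′)) w≈w′
  conic-form-cong (⊎.inj₂ _) t≈t′ w≈w′ = λ where
    0F → refl
    1F → refl
    2F → refl
    3F → w≈w′
    4F → refl
    5F → t≈t′

  conic-form-injective : ∀ {p p′ t t′ w w′} →
    conic-form (p , t , w) ∼ conic-form (p′ , t′ , w′) → p ≈ₚ p′ × t ≈ t′ × w ≈ w′
  conic-form-injective {inj₁ s} {inj₁ s′} {t} {t′} {w} {w′} (k , k≉0 , eq) =
    ⊎.inj₁ s≈s′ , t≈t′ , +-cancelˡ (t * (s * s)) w w′ (trans (scale-1 (eq 1F) (eq 5F))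
      (+-congʳ (sym (*-cong t≈t′ (*-cong s≈s′ s≈s′)))))
    where
    s≈s′ = scale-1 (eq 1F) (eq 2F)
    t≈t′ = scale-1 (eq 1F) (eq 3F)
  conic-form-injective {inj₁ s}  {inj₂ _}  (k , k≉0 , eq) = contradiction (eq 1F) 1≉k0
  conic-form-injective {inj₂ _}  {inj₁ s′} (k , k≉0 , eq) = contradiction (eq 1F) (0≉k1 k≉0)
  conic-form-injective {inj₂ 0F} {inj₂ 0F} (k , k≉0 , eq) =
    ⊎.inj₂ ≡.refl , scale-1 (eq 2F) (eq 5F) , scale-1 (eq 2F) (eq 3F)

  conic-form-surjective : ∀ {a} → ¬ (nucleus a ≋ λ _ → 0#) → a 0F ≈ 0# → a 4F ≈ 0# →
    ∃[ x ] a ∼ conic-form x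
  conic-form-surjective {a} n≉0 a₀≈0 a₄≈0 with a 1F ≟ 0# | a 2F ≟ 0#
  -- The last component is what remains of the scaled entry at `5F` after `t * (s * s)`; in
  -- characteristic 2 subtracting is adding.
  ... | no a₁≉0 | _ = (inj₁ s , t , t * (s * s) + a₁⁻¹ * a 5F) , a 1F , a₁≉0 , λ where
      0F → zero-entry a₀≈0
      1F → one-entry
      2F → rescale a₁≉0 (a 2F)
      3F → rescale a₁≉0 (a 3F)
      4F → zero-entry a₄≈0
      5F → trans (rescale a₁≉0 (a 5F)) (*-congˡ (solve 2 (λ x y → y := x :+ (x :+ y)) refl (t * (s * s)) (a₁⁻¹ * a 5F)))
    where
    a₁⁻¹ = proj₁ (invertible a₁≉0)
    s = a₁⁻¹ * a 2F
    t = a₁⁻¹ * a 3F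
  ... | yes a₁≈0 | no a₂≉0 = (inj₂ 0F , _ , _) , a 2F , a₂≉0 , λ where
    0F → zero-entry a₀≈0
    1F → zero-entry a₁≈0
    2F → one-entry
    3F → rescale a₂≉0 (a 3F)
    4F → zero-entry a₄≈0
    5F → rescale a₂≉0 (a 5F)
  ... | yes a₁≈0 | yes a₂≈0 = contradiction (λ where
    0F → a₄≈0
    1F → a₂≈0
    2F → a₁≈0) n≉0

  -- At the nucleus (0, c, b) the vector t (b², c²) contributes t b² c² twice, hence nothing. The
  -- complementary vectors are chosen so that the rest is exactly `w`.
  discriminant-conic-form : ∀ p t w → discriminant (conic-form (p , t , w)) ≈ w
  discriminant-conic-form (inj₁ s) t w = trans (discriminant≈nucleus (conic-form (inj₁ s , t , w))) (solve 3
    (λ s t w →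
      let a = con false ∷ con true ∷ s ∷ t ∷ con false ∷ t :* (s :* s) :+ w ∷ []
          n = con false ∷ s ∷ con true ∷ [] in
      a ·ᵖ (λ t → n (row t) :* n (col t)) := w) refl s t w)
  discriminant-conic-form (inj₂ i) t w = trans (discriminant≈nucleus (conic-form (inj₂ i , t , w))) (solve 2
    (λ t w →
      let a = con false ∷ con false ∷ con true ∷ w ∷ con false ∷ t ∷ []
          n = con false ∷ con true ∷ con false ∷ [] in
      a ·ᵖ (λ t → n (row t) :* n (col t)) := w) refl t w)

  conic-form-product : ∀ p t → Σ[ l ∈ LinearForm ] Σ[ m ∈ LinearForm ]
    ¬ l ∼ m × conic-form (p , t , 0#) ≋ l ⊗ m
  conic-form-product (inj₁ s) t = 0# ∷ 1# ∷ s ∷ [] , 1# ∷ t ∷ t * s ∷ [] ,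
    (λ (_ , k≉0 , eq) → 0≉k1 k≉0 (eq 0F)) , λ where
    0F → sym (zeroˡ _)
    1F → solve 1 (λ t → con true := con false :* t :+ con true :* con true) refl t
    2F → solve 2 (λ s t → s := con false :* (t :* s) :+ s :* con true) refl s t
    3F → sym (*-identityˡ _)
    4F → solve 2 (λ s t → con false := con true :* (t :* s) :+ s :* t) refl s t
    5F → solve 2 (λ s t → t :* (s :* s) :+ con false := s :* (t :* s)) refl s t
  conic-form-product (inj₂ _) t = 0# ∷ 0# ∷ 1# ∷ [] , 1# ∷ 0# ∷ t ∷ [] ,
    (λ (_ , k≉0 , eq) → 0≉k1 k≉0 (eq 0F)) , λ where
    0F → sym (zeroˡ _)
    1F → solve 0 (con false := con false :* con false :+ con false :* con true) refl
    2F → solve 1 (λ t → con true := con false :* t :+ con true :* con true) refl t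
    3F → sym (zeroˡ _)
    4F → solve 1 (λ t → con false := con false :* t :+ con true :* con false) refl t
    5F → sym (*-identityˡ _)

  conic-form-nonzero : ∀ x → ¬ (conic-form x ≋ λ _ → 0#)
  conic-form-nonzero (inj₁ s , _) eq = 1≉0 (eq 1F)
  conic-form-nonzero (inj₂ _ , _) eq = 1≉0 (eq 2F)

  conic-form₀ : ∀ x → conic-form x 0F ≈ 0#
  conic-form₀ (inj₁ _ , _) = refl
  conic-form₀ (inj₂ _ , _) = refl

  conic-form₄ : ∀ x → conic-form x 4F ≈ 0#
  conic-form₄ (inj₁ _ , _) = refl
  conic-form₄ (inj₂ _ , _) = refl

  ⊗-≉0 : ∀ {l m} → ¬ (l ⊗ m ≋ λ _ → 0#) → ¬ (l ≋ λ _ → 0#) × ¬ (m ≋ λ _ → 0#)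
  ⊗-≉0 {l} {m} lm≉0 =
      (λ l≈0 → lm≉0 (λ i → trans (⊗-cong {m = m} l≈0 (λ _ → refl) i) (0⊗ m i)))
    , (λ m≈0 → lm≉0 (λ i → trans (⊗-cong {l = l} (λ _ → refl) m≈0 i)
                                 (trans (⊗-comm l (λ _ → 0#) i) (0⊗ l i))))
    where
    0⊗ : ∀ m → (λ _ → 0#) ⊗ m ≋ λ _ → 0#
    0⊗ m 0F = zeroˡ _
    0⊗ m 1F = trans (+-cong (zeroˡ _) (zeroˡ _)) (+-identityˡ _)
    0⊗ m 2F = trans (+-cong (zeroˡ _) (zeroˡ _)) (+-identityˡ _)
    0⊗ m 3F = zeroˡ _
    0⊗ m 4F = trans (+-cong (zeroˡ _) (zeroˡ _)) (+-identityˡ _)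
    0⊗ m 5F = zeroˡ _

  -- The entries of nucleus (l ⊗ m) are the 2 × 2 minors of l and m.
  nucleus-⊗⇒∼ : ∀ {l m} → ¬ (l ⊗ m ≋ λ _ → 0#) → nucleus (l ⊗ m) ≋ (λ _ → 0#) → l ∼ m
  nucleus-⊗⇒∼ {l} {m} lm≉0 n≈0 = minors⇒∼ (proj₁ (⊗-≉0 {l} {m} lm≉0)) (proj₂ (⊗-≉0 {l} {m} lm≉0)) λ where
      0F 0F → refl
      0F 1F → x+y≈0⇒x≈y (n≈0 2F)
      0F 2F → x+y≈0⇒x≈y (n≈0 1F)
      1F 0F → sym (x+y≈0⇒x≈y (n≈0 2F))
      1F 1F → refl
      1F 2F → x+y≈0⇒x≈y (n≈0 0F)
      2F 0F → sym (x+y≈0⇒x≈y (n≈0 1F))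
      2F 1F → sym (x+y≈0⇒x≈y (n≈0 0F))
      2F 2F → refl
    where
    x+y≈0⇒x≈y : ∀ {x y} → x + y ≈ 0# → x ≈ y
    x+y≈0⇒x≈y {x} {y} x+y≈0 = trans (solve 2 (λ x y → x := x :+ y :+ y) refl x y)
      (trans (+-congʳ x+y≈0) (+-identityˡ y))

-- Counting double lines, real line pairs and non-singular conics.

module Counting {q : ℕ} (F : FiniteField q c ℓ) (2∣q : 2 ∣ q) where
  open FiniteField F hiding (zero)
  open ConicProperties F 2∣q
  open NormalForms F 2∣q
  open Projective F
  open Hyperplanes F
  open SetoidReasoning setoid

  module Through (L : Line) (g : GL₃) (L≐ : points L ≐ g ∙ representative₈,₃) where
    private
      A B : Matrix
      A = proj₁ g
      B = proj₁ (proj₂ g)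
      BA≈I : ∀ i j → (B ⊡ A) i j ≈ identity i j
      BA≈I = proj₁ (proj₂ (proj₂ g))
      AB≈I : ∀ i j → (A ⊡ B) i j ≈ identity i j
      AB≈I = proj₂ (proj₂ (proj₂ g))

    -- The common argument of the three counts. The normal forms live in coordinates adapted to the
    -- representative line: substituting `B` turns them into hyperplanes through `L`, and
    -- substituting `A` brings a hyperplane back for comparison.
    through-size : {n : ℕ} {S : Setoid a ℓ′} {ℋ : Pred Hyperplane p} → (let module S = Setoid S) →
      HasSize S n →
      (form : S.Carrier → QuadraticForm) →
      (∀ {x y} → x S.≈ y → form x ≋ form y) →
      (∀ {x y} → form x ∼ form y → x S.≈ y) →
      (∀ x → ¬ (form x ≋ λ _ → 0#)) →
      (∀ x → form x 0F ≈ 0#) →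
      (∀ x → form x 4F ≈ 0#) →
      (∀ x (nonzero : ¬ (form x ◃ B ≋ λ _ → 0#)) → (form x ◃ B , nonzero) ∈ ℋ) →
      (∀ {H} → H ∈ ℋ → (proj₁ H ◃ A) 0F ≈ 0# → (proj₁ H ◃ A) 4F ≈ 0# → ∃[ x ] proj₁ H ◃ A ∼ form x) →
      HasSize (through ℋ L) n
    through-size sizeS form form-cong form-injective form-nonzero form₀ form₄ member complete =
      hasSize-via sizeS
        (λ x → let H = form x ◃ B , ◃-≉0 B A BA≈I (form-nonzero x) in
          H , member x (proj₂ H)
            , ⇒Contains g L L≐ H (trans (◃-inverse B A BA≈I (form x) 0F) (form₀ x))
                                  (trans (◃-inverse B A BA≈I (form x) 4F) (form₄ x)))
        (λ x≈y → ≋⇒∼ (◃-cong (form-cong x≈y) B))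
        (λ {x} {y} eq → form-injective (∼-trans (≋⇒∼ (λ i → sym (◃-inverse B A BA≈I (form x) i)))
          (∼-trans (◃-∼ A eq) (≋⇒∼ (◃-inverse B A BA≈I (form y))))))
        λ (H , H∈ℋ , L⊆H) →
          let a′₀≈0 , a′₄≈0 = Contains⇒ g L L≐ H L⊆H
              x , eq = complete {H} H∈ℋ a′₀≈0 a′₄≈0 in
          x , ∼-sym (∼-trans (≋⇒∼ (λ i → sym (◃-inverse A B AB≈I (proj₁ H) i))) (◃-∼ B eq))

    ℋ₁-size : HasSize (through ℋ₁ L) (q ℕ.+ 1)
    ℋ₁-size = through-size Parameter-size line-form line-form-cong line-form-injective line-form-nonzero
      (λ { (inj₁ _) → refl ; (inj₂ _) → refl })
      (λ { (inj₁ _) → refl ; (inj₂ _) → refl })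
      (λ p _ → let l , form≈l⊗l = line-form-square p in
        1# , l ⊙ B , λ i → trans (◃-cong form≈l⊗l B i) (trans (⊗-◃ l l B i) (sym (*-identityˡ _))))
      λ {(a , a≉0)} (k , l , a≈kl⊗l) a′₀≈0 _ →
        let a′≈ : a ◃ A ≋ λ i → k * ((l ⊙ A) ⊗ (l ⊙ A)) i
            a′≈ = λ i → trans (◃-cong a≈kl⊗l A i) (trans (◃-scale k (l ⊗ l) A i) (*-congˡ (⊗-◃ l l A i))) in
        line-form-surjective (◃-≉0 A B AB≈I a≉0) a′₀≈0
          (λ i → trans (nucleus-cong a′≈ i) (nucleus-multiple k (l ⊙ A) i))
      where
      nucleus-multiple : ∀ k l → nucleus (λ i → k * (l ⊗ l) i) ≋ (λ _ → 0#)
      nucleus-multiple k l 0F = trans (*-congˡ (nucleus-square l 0F)) (zeroʳ k)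
      nucleus-multiple k l 1F = trans (*-congˡ (nucleus-square l 1F)) (zeroʳ k)
      nucleus-multiple k l 2F = trans (*-congˡ (nucleus-square l 2F)) (zeroʳ k)

    ℋ₂ᵣ-size : HasSize (through ℋ₂ᵣ L) ((q ℕ.+ 1) ℕ.* q)
    ℋ₂ᵣ-size = through-size (hasSize-× Parameter-size size)
      (λ (p , t) → conic-form (p , t , 0#))
      (λ (p≈p′ , t≈t′) → conic-form-cong p≈p′ t≈t′ refl)
      (λ eq → let p≈p′ , t≈t′ , _ = conic-form-injective eq in p≈p′ , t≈t′)
      (λ (p , t) → conic-form-nonzero (p , t , 0#))
      (λ (p , t) → conic-form₀ (p , t , 0#))
      (λ (p , t) → conic-form₄ (p , t , 0#))
      (λ (p , t) _ → let l , m , l≁m , form≈l⊗m = conic-form-product p t in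
        l ⊙ B , m ⊙ B
        , l≁m ∘ ⊙-∼⁻¹ B A BA≈I {l} {m}
        , λ i → trans (◃-cong form≈l⊗m B i) (⊗-◃ l m B i))
      λ {(a , a≉0)} (l , m , l≁m , a≈l⊗m) a′₀≈0 a′₄≈0 →
        let a′≈ : a ◃ A ≋ (l ⊙ A) ⊗ (m ⊙ A)
            a′≈ = λ i → trans (◃-cong a≈l⊗m A i) (⊗-◃ l m A i)
            (p , t , w) , a′∼ = conic-form-surjective {a ◃ A}
              -- With zero nucleus the factors would be proportional after substituting `A`, hence
              -- also before.
              (λ n≈0 → l≁m (⊙-∼⁻¹ A B AB≈I {l} {m} (nucleus-⊗⇒∼ {l ⊙ A} {m ⊙ A}
                (λ eq → ◃-≉0 A B AB≈I a≉0 (λ i → trans (a′≈ i) (eq i)))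
                (λ i → trans (sym (nucleus-cong a′≈ i)) (n≈0 i)))))
              a′₀≈0 a′₄≈0
            -- A product has discriminant zero, and the discriminant of the normal form is `w`.
            Δ′≈0 = trans (discriminant-cong {a ◃ A} {(l ⊙ A) ⊗ (m ⊙ A)} a′≈) (discriminant-⊗ (l ⊙ A) (m ⊙ A))
            w≈0 = trans (sym (discriminant-conic-form p t w)) (discriminant-∼ a′∼ Δ′≈0) in
        (p , t) , ∼-trans a′∼ (≋⇒∼ (conic-form-cong (Setoid.refl Parameter {p}) refl w≈0))

    ℋ₃-size : HasSize (through ℋ₃ L) ((q ℕ.+ 1) ℕ.* (q ℕ.* (q ∸ 1)))
    -- The discriminant `w` now ranges over the units, which gives the factor `q ∸ 1`.
    ℋ₃-size = through-size (hasSize-× Parameter-size (hasSize-× size units-size))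
      (λ (p , t , w , _) → conic-form (p , t , w))
      (λ (p≈p′ , t≈t′ , w≈w′) → conic-form-cong p≈p′ t≈t′ w≈w′)
      conic-form-injective
      (λ (p , t , w , _) → conic-form-nonzero (p , t , w))
      (λ (p , t , w , _) → conic-form₀ (p , t , w))
      (λ (p , t , w , _) → conic-form₄ (p , t , w))
      -- If the discriminant vanished after substituting `B`, it would still vanish after
      -- substituting `A` back, where it equals `w`.
      (λ (p , t , w , w≉0) _ Δ≈0 → w≉0 (begin
        w
          ≈⟨ discriminant-conic-form p t w ⟨
        discriminant (conic-form (p , t , w))
          ≈⟨ discriminant-cong {conic-form (p , t , w) ◃ B ◃ A} (◃-inverse B A BA≈I (conic-form (p , t , w))) ⟨
        discriminant (conic-form (p , t , w) ◃ B ◃ A)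
          ≈⟨ discriminant-◃-zero (conic-form (p , t , w) ◃ B) A Δ≈0 ⟩
        0#
          ∎))
      λ {(a , a≉0)} Δ≉0 a′₀≈0 a′₄≈0 →
        let Δ′≉0 : ¬ discriminant (a ◃ A) ≈ 0#
            Δ′≉0 = λ Δ′≈0 → Δ≉0 (trans (sym (discriminant-cong {a ◃ A ◃ B} (◃-inverse A B AB≈I a)))
                                       (discriminant-◃-zero (a ◃ A) B Δ′≈0))
            (p , t , w) , a′∼ = conic-form-surjective {a ◃ A}
              -- The discriminant is the value at the nucleus, so it would vanish together with the
              -- nucleus.
              (λ n≈0 → Δ′≉0 (trans (discriminant≈nucleus (a ◃ A))
                (·-zeroʳ (a ◃ A) (λ i → trans (*-congʳ (n≈0 (row i))) (zeroˡ (nucleus (a ◃ A) (col i)))))))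
              a′₀≈0 a′₄≈0 in
        (p , t , w , λ w≈0 → Δ′≉0 (discriminant-∼ (∼-sym a′∼) (trans (discriminant-conic-form p t w) w≈0))) , a′∼

-- Pairs of conjugate imaginary lines.

module ImaginaryPairs {q : ℕ} (F : FiniteField q c ℓ) (2∣q : 2 ∣ q) (E : QuadraticExtension F) where
  open Vector using ([]; _∷_)
  private module F where
    open FiniteField F public
    open NormalForms F 2∣q public
    open ConicProperties F 2∣q public
    open Projective F public

  open QuadraticExtension E hiding (zero; LinearForm; _⊗_; _∼_)
  2∣q² : 2 ∣ q ℕ.^ 2
  -- `q ^ 2` unfolds to `q * (q * 1)`.
  2∣q² = ∣m⇒∣m*n (q ℕ.* 1) 2∣q
  open ConicProperties field-q² 2∣q²
  open NormalForms field-q² 2∣q²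
  open Projective field-q²
  open IsRingHomomorphism ι-isHomomorphism
  open SetoidReasoning setoid

  -- A ring homomorphism sends units to units.
  ι-≉0 : ∀ {x} → ¬ x F.≈ F.0# → ¬ ι x ≈ 0#
  ι-≉0 x≉0 with x⁻¹ , _ , xx⁻¹≈1 ← F.invertible x≉0 =
    inverse≉0 (trans (sym (*-homo _ x⁻¹)) (trans (⟦⟧-cong xx⁻¹≈1) 1#-homo))

  ι≈0⇒≈0 : ∀ {x} → ι x ≈ 0# → x F.≈ F.0#
  ι≈0⇒≈0 {x} ιx≈0 = decidable-stable (x F.≟ F.0#) (λ x≉0 → ι-≉0 x≉0 ιx≈0)

  ι-· : ∀ {n} (u v : Vector F.Carrier n) → ι (u F.· v) ≈ (ι ∘ u) · (ι ∘ v)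
  ι-· {zero}  u v = 0#-homo
  ι-· {suc n} u v = trans (+-homo _ _) (+-cong (*-homo _ _) (ι-· (u ∘ suc) (v ∘ suc)))

  ι-⊗ : ∀ l m → ι ∘ (l F.⊗ m) ≋ (ι ∘ l) ⊗ (ι ∘ m)
  ι-⊗ l m 0F = *-homo _ _
  ι-⊗ l m 1F = trans (+-homo _ _) (+-cong (*-homo _ _) (*-homo _ _))
  ι-⊗ l m 2F = trans (+-homo _ _) (+-cong (*-homo _ _) (*-homo _ _))
  ι-⊗ l m 3F = *-homo _ _
  ι-⊗ l m 4F = trans (+-homo _ _) (+-cong (*-homo _ _) (*-homo _ _))
  ι-⊗ l m 5F = *-homo _ _

  ιₘ : F.Matrix → Matrix
  ιₘ A i j = ι (A i j)

  ι-◃ : ∀ a A → ι ∘ (a F.◃ A) ≋ (ι ∘ a) ◃ ιₘ A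
  ι-◃ a A k = trans (ι-· a (λ t → (A (F.row t) F.⊗ A (F.col t)) k))
    (·-cong {u = ι ∘ a} (λ _ → refl) (λ t → ι-⊗ (A (row t)) (A (col t)) k))

  ι-identity : ∀ i j → ι (F.identity i j) ≈ identity i j
  ι-identity = λ where
    0F 0F → 1#-homo
    0F 1F → 0#-homo
    0F 2F → 0#-homo
    1F 0F → 0#-homo
    1F 1F → 1#-homo
    1F 2F → 0#-homo
    2F 0F → 0#-homo
    2F 1F → 0#-homo
    2F 2F → 1#-homo

  ι-inverse : ∀ A B → (∀ i j → (A F.⊡ B) i j F.≈ F.identity i j) →
    ∀ i j → (ιₘ A ⊡ ιₘ B) i j ≈ identity i j
  ι-inverse A B AB≈I i j = trans (sym (ι-· (A i) (λ k → B k j)))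
    (trans (⟦⟧-cong (AB≈I i j)) (ι-identity i j))

  ι-power : ∀ x n → ι (x F.^ᶠ n) ≈ ι x ^ᶠ n
  ι-power x zero    = 1#-homo
  ι-power x (suc n) = trans (*-homo _ _) (*-congˡ (ι-power x n))

  -- Two `q`-th powers make a power with exponent `q ^ 2`, the identity by Fermat's theorem in the
  -- extension.
  conjugate-conjugate : ∀ l → conjugate (conjugate l) ≋ l
  conjugate-conjugate l i = begin
    (l i ^ᶠ q) ^ᶠ q      ≈⟨ ^-assocʳ (l i) q q ⟩
    l i ^ᶠ (q ℕ.* q)     ≈⟨ ^-congʳ (l i) (≡.cong (q ℕ.*_) (≡.sym (ℕ.*-identityʳ q))) ⟩
    l i ^ᶠ (q ℕ.^ 2)     ≈⟨ fermat (l i) ⟩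
    l i                  ∎

  power≉0 : ∀ {x} → ¬ x ≈ 0# → ∀ n → ¬ x ^ᶠ n ≈ 0#
  power≉0 x≉0 zero    = 1≉0
  power≉0 x≉0 (suc n) = *-≉0 x≉0 (power≉0 x≉0 n)

  -- A form proportional to a rational one is proportional to its conjugate,
  -- because x ^ q ≈ x in F.
  rational⇒∼-conjugate : ∀ {k l} (r : F.LinearForm) → ¬ k ≈ 0# →
    (λ i → k * l i) ≋ ι ∘ r → l ∼ conjugate l
  rational⇒∼-conjugate {k} {l} r k≉0 kl≈r with k⁻¹ , _ , kk⁻¹≈1 ← invertible k≉0 =
    k⁻¹ * k ^ᶠ q , *-≉0 (inverse≉0 (trans (*-comm k⁻¹ k) kk⁻¹≈1)) (power≉0 k≉0 q) , λ i → *-cancelˡ k≉0 (begin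
      k * l i                            ≈⟨ kl≈r i ⟩
      ι (r i)                            ≈⟨ ⟦⟧-cong (F.fermat (r i)) ⟨
      ι (r i F.^ᶠ q)                     ≈⟨ ι-power (r i) q ⟩
      ι (r i) ^ᶠ q                       ≈⟨ ^-congˡ q (kl≈r i) ⟨
      (k * l i) ^ᶠ q                     ≈⟨ ^-distrib-* k (l i) q ⟩
      k ^ᶠ q * l i ^ᶠ q                  ≈⟨ *-identityˡ _ ⟨
      1# * (k ^ᶠ q * l i ^ᶠ q)           ≈⟨ *-congʳ kk⁻¹≈1 ⟨
      k * k⁻¹ * (k ^ᶠ q * l i ^ᶠ q)      ≈⟨ solve 4 (λ x y z w → x :* y :* (z :* w) := x :* (y :* z :* w)) refl k k⁻¹ (k ^ᶠ q) (l i ^ᶠ q) ⟩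
      k * (k⁻¹ * k ^ᶠ q * l i ^ᶠ q)      ∎)

  -- The cases are distinguished by the values `m 0F` and `m̄ 0F` of the two linear forms at the
  -- rational point A e₀.
  not-imaginary : ∀ A B → (∀ i j → (A F.⊡ B) i j F.≈ F.identity i j) →
    ∀ {a k l} → ¬ (a F.≋ λ _ → F.0#) →
    (a F.◃ A) 0F F.≈ F.0# → (a F.◃ A) 4F F.≈ F.0# →
    (∀ i → ι (a i) ≈ ι k * (l ⊗ conjugate l) i) → l ∼ conjugate l
  not-imaginary A B AB≈I {a} {k} {l} a≉0 a′₀≈0 a′₄≈0 a≈kl⊗l̄ =
    by-cases (m 0F ≟ 0#) (m̄ 0F ≟ 0#)
    where
    κ = ι k
    l̄ = conjugate l
    m = l ⊙ ιₘ A
    m̄ = l̄ ⊙ ιₘ A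
    -- The rational candidate, up to a scalar, for a line through A e₀: it has no X₀ term, and its
    -- other coefficients are taken from the conic.
    u₀ : F.LinearForm
    u₀ = F.0# ∷ (a F.◃ A) 1F ∷ (a F.◃ A) 2F ∷ []
    ιAB≈I : ∀ i j → (ιₘ A ⊡ ιₘ B) i j ≈ identity i j
    ιAB≈I = ι-inverse A B AB≈I
    ll̄≉0 : ¬ (l ⊗ l̄ ≋ λ _ → 0#)
    ll̄≉0 ll̄≈0 = a≉0 (λ i → ι≈0⇒≈0 (trans (a≈kl⊗l̄ i) (trans (*-congˡ (ll̄≈0 i)) (zeroʳ κ))))
    κ≉0 : ¬ κ ≈ 0#
    κ≉0 κ≈0 = a≉0 (λ i → ι≈0⇒≈0 (trans (a≈kl⊗l̄ i) (trans (*-congʳ κ≈0) (zeroˡ ((l ⊗ l̄) i)))))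
    a′≈ : ∀ i → ι ((a F.◃ A) i) ≈ κ * (m ⊗ m̄) i
    a′≈ i = begin
      ι ((a F.◃ A) i)                        ≈⟨ ι-◃ a A i ⟩
      ((ι ∘ a) ◃ ιₘ A) i                     ≈⟨ ◃-cong {a = ι ∘ a} {b = λ j → κ * (l ⊗ l̄) j} a≈kl⊗l̄ (ιₘ A) i ⟩
      ((λ j → κ * (l ⊗ l̄) j) ◃ ιₘ A) i       ≈⟨ ◃-scale κ (l ⊗ l̄) (ιₘ A) i ⟩
      κ * ((l ⊗ l̄) ◃ ιₘ A) i                 ≈⟨ *-congˡ (⊗-◃ l l̄ (ιₘ A) i) ⟩
      κ * (m ⊗ m̄) i                          ∎
    vanish : ∀ i → (a F.◃ A) i F.≈ F.0# → (m ⊗ m̄) i ≈ 0#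
    vanish i a′ᵢ≈0 = *-cancelˡ κ≉0 (trans (sym (a′≈ i)) (trans (⟦⟧-cong a′ᵢ≈0) (trans 0#-homo (sym (zeroʳ κ)))))
    mm̄≉0 : ¬ (m ⊗ m̄ ≋ λ _ → 0#)
    mm̄≉0 eq = ◃-≉0 (ιₘ A) (ιₘ B) ιAB≈I ll̄≉0 (λ i → trans (⊗-◃ l l̄ (ιₘ A) i) (eq i))

    both : m 0F ≈ 0# → m̄ 0F ≈ 0# → l ∼ l̄
    -- The first entry of the nucleus is the missing X₁X₂ coefficient, and every term of the other
    -- two contains `m 0F` or `m̄ 0F`.
    both m₀≈0 m̄₀≈0 = ⊙-∼⁻¹ (ιₘ A) (ιₘ B) ιAB≈I {l} {l̄} (nucleus-⊗⇒∼ {m} {m̄} mm̄≉0 λ where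
        0F → vanish 4F a′₄≈0
        1F → zero-sum (m 2F) (m̄ 2F)
        2F → zero-sum (m 1F) (m̄ 1F))
      where
      zero-sum : ∀ x y → m 0F * y + x * m̄ 0F ≈ 0#
      zero-sum x y = trans
        (+-cong (trans (*-congʳ m₀≈0) (zeroˡ y)) (trans (*-congˡ m̄₀≈0) (zeroʳ x))) (+-identityˡ 0#)

    -- The line v passes through the rational point A e₀, so that the X₀X₁ and X₀X₂
    -- coefficients of the conic are κ w₀ times those of v.
    rational : ∀ v w → (∀ i → ι ((a F.◃ A) i) ≈ κ * (v ⊗ w) i) → v 0F ≈ 0# →
      (λ i → κ * w 0F * (v ⊙ ιₘ B) i) ≋ ι ∘ (u₀ F.⊙ B)
    rational v w a′≈vw v₀≈0 j = begin
      κ * w 0F * (v ⊙ ιₘ B) j                        ≈⟨ ·-scaleˡ (κ * w 0F) v (λ i → ιₘ B i j) ⟨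
      (λ i → κ * w 0F * v i) · (λ i → ιₘ B i j)      ≈⟨ ·-cong {v = λ i → ιₘ B i j} coefficient (λ _ → refl) ⟩
      (ι ∘ u₀) · (λ i → ιₘ B i j)                    ≈⟨ ι-· u₀ (λ i → B i j) ⟨
      ι ((u₀ F.⊙ B) j)                                        ∎
      where
      drop-v₀ : ∀ x y → κ * (v 0F * x + y * w 0F) ≈ κ * w 0F * y
      drop-v₀ x y = trans
        (*-congˡ (trans (+-congʳ (trans (*-congʳ v₀≈0) (zeroˡ x))) (+-identityˡ _)))
        (solve 3 (λ κ y w → κ :* (y :* w) := κ :* w :* y) refl κ y (w 0F))
      coefficient : ∀ i → κ * w 0F * v i ≈ ι (u₀ i)
      coefficient 0F = trans (*-congˡ v₀≈0) (trans (zeroʳ _) (sym 0#-homo))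
      coefficient 1F = sym (trans (a′≈vw 1F) (drop-v₀ (w 1F) (v 1F)))
      coefficient 2F = sym (trans (a′≈vw 2F) (drop-v₀ (w 2F) (v 2F)))

    by-cases : Dec (m 0F ≈ 0#) → Dec (m̄ 0F ≈ 0#) → l ∼ l̄
    by-cases (yes m₀≈0) (yes m̄₀≈0) = both m₀≈0 m̄₀≈0
    by-cases (yes m₀≈0) (no m̄₀≉0)  = rational⇒∼-conjugate (u₀ F.⊙ B) (*-≉0 κ≉0 m̄₀≉0) λ i →
      trans (*-congˡ (sym (⊙-inverse (ιₘ A) (ιₘ B) ιAB≈I l i))) (rational m m̄ a′≈ m₀≈0 i)
    -- Here the argument applies to the conjugate line, whose own conjugate is `l` again.
    by-cases (no m₀≉0)  (yes m̄₀≈0) = ∼-sym (∼-trans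
      (rational⇒∼-conjugate {l = l̄} (u₀ F.⊙ B) (*-≉0 κ≉0 m₀≉0) λ i →
        trans (*-congˡ (sym (⊙-inverse (ιₘ A) (ιₘ B) ιAB≈I l̄ i)))
          (rational m̄ m (λ j → trans (a′≈ j) (*-congˡ (⊗-comm m m̄ j))) m̄₀≈0 i))
      (≋⇒∼ (conjugate-conjugate l)))
    -- The missing X₀² coefficient forces at least one of the lines through A e₀.
    by-cases (no m₀≉0)  (no m̄₀≉0)  = contradiction (vanish 0F a′₀≈0) (*-≉0 m₀≉0 m̄₀≉0)

-- Arithmetic of the counts and the resulting distribution.

open import Data.Nat.Base using (_+_; _^_)
open import Data.Vec.Base using (_∷_; [])
private
  open +-*-Solver

  ℋ₂ᵣ-count : ∀ q → (q + 1) ℕ.* q ≡ q ^ 2 + q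
  ℋ₂ᵣ-count = solve 1 (λ q → (q :+ con 1) :* q := q :^ 2 :+ q) ≡.refl

  ℋ₃-count : ∀ q → (q + 1) ℕ.* (q ℕ.* (q ∸ 1)) ≡ q ^ 3 ∸ q
  ℋ₃-count zero    = ≡.refl
  -- The solver shows that the product plus `suc n` is the cube; cancelling `suc n` then accounts
  -- for the truncated subtraction.
  ℋ₃-count (suc n) = ≡.trans (≡.sym (ℕ.m+n∸n≡m _ (suc n))) (≡.cong (_∸ suc n)
    (solve 1 (λ n → (con 1 :+ n :+ con 1) :* ((con 1 :+ n) :* n) :+ (con 1 :+ n) := (con 1 :+ n) :^ 3)
      ≡.refl n))

lemma4p6 : ∀ {c ℓ : Level} (q : ℕ) → IsEvenPrimePower q →
    (F : FiniteField q c ℓ) →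
    let open Projective F
        open Hyperplanes F in
    (L : Line) → L ∈ o₈,₃ →
    HasOD₄ L (q + 1 ∷ q ^ 2 + q ∷ 0 ∷ q ^ 3 ∸ q ∷ [])
lemma4p6 q (_ , 2∣q) F L (g@(A , B , _ , AB≈I) , L≐) =
    ℋ₁-size
  , ≡.subst (HasSize (through ℋ₂ᵣ L)) (ℋ₂ᵣ-count q) ℋ₂ᵣ-size
  -- A member of this class through `L` would have a line both distinct from and proportional to its
  -- conjugate.
  , hasSize-empty (λ ((a , a≉0) , (E , k , l , l≁l̄ , a≈kl⊗l̄) , L⊆H) →
      let a′₀≈0 , a′₄≈0 = Contains⇒ g L L≐ (a , a≉0) L⊆H in
      l≁l̄ (ImaginaryPairs.not-imaginary F 2∣q E A B AB≈I a≉0 a′₀≈0 a′₄≈0 a≈kl⊗l̄))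
  , ≡.subst (HasSize (through ℋ₃ L)) (ℋ₃-count q) ℋ₃-size
  where
  open Projective F
  open Hyperplanes F
  open NormalForms F 2∣q
  open Counting F 2∣q
  open Through L g L≐
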